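{- For each variety $\mathbf{K}\in\Xi(\mathbf{S4})$, $$\mathsf{Log}(\sigma(\rho(\mathbf{K})))=Schem(\mathsf{Log}(\mathbf{K})^{\Box}).$$ Consequently, a logic (in the sense of axiomatic extension) $L\in\mathbf{NExt}(\mathsf{S4})$ is $\Box$-maximal if and only if it is the greatest modal companion of $\rho(L)$.
   Context: $\mathbf{S4}$ is the variety of S4-algebras: Boolean algebras with a unary $\Box$ satisfying $\Box1=1$, $\Box(a\wedge b)=\Box a\wedge\Box b$, $\Box a\le a$, $\Box a\le\Box\Box a$. In this statement $\Xi(\mathbf{S4})$ is the lattice of subvarieties of $\mathbf{S4}$. $\mathbf{NExt}(\mathsf{S4})$ is the lattice of normal axiomatic extensions of $\mathsf{S4}$ (sets of modal formulas), and $\Lambda(\mathsf{IPC})$ is the lattice of axiomatic extensions (superintuitionistic logics) of $\mathsf{IPC}$. For a class $\mathbf{K}$ of algebras, $\mathsf{Log}(\mathbf{K})$ is the set of formulas $\phi$ such that $\phi\approx1$ is valid in all members of $\mathbf{K}$. The translation $GMT$ from intuitionistic to modal formulas: $GMT(p)=\Box p$, $GMT(\top)=\top$, $GMT(\bot)=\bot$, $GMT$ commutes with $\wedge,\vee$, and $GMT(\phi\to\psi)=\Box(\neg GMT(\phi)\vee GMT(\psi))$. $M\in\mathbf{NExt}(\mathsf{S4})$ is a modal companion of $L\in\Lambda(\mathsf{IPC})$ if for all intuitionistic $\phi$: $\phi\in L\iff GMT(\phi)\in M$. For $M\in\mathbf{NExt}(\mathsf{S4})$, $\rho(M)=\{\phi:GMT(\phi)\in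 M\}\in\Lambda(\mathsf{IPC})$. For an S4-algebra $\mathcal{B}$, $\mathcal{B}_\Box=\{a\in B:a=\Box a\}$ is a Heyting algebra with the inherited $0,1,\wedge,\vee$ and implication $\Box(\neg a\vee b)$. For a variety $\mathbf{K}$ of S4-algebras, $\rho(\mathbf{K})=\{\mathcal{B}_\Box:\mathcal{B}\in\mathbf{K}\}$. For a Heyting algebra $\mathcal{H}$, $B(\mathcal{H})$ is its Boolean envelope: the Boolean algebra generated by $\mathcal{H}$, realized inside the powerset of the set of prime filters of $\mathcal{H}$ via $a\mapsto\{x:a\in x\}$, with $\Box\bigl(\bigwedge_{i=1}^n(\neg c_i\vee d_i)\bigr)=\bigwedge_{i=1}^n(c_i\to d_i)$ for $c_i,d_i\in H$, where $\to$ is Heyting implication; it is an S4-algebra. For a variety $\mathbf{P}$ of Heyting algebras, $\sigma(\mathbf{P})=\mathbb{HSP}\{B(\mathcal{H}):\mathcal{H}\in\mathbf{P}\}$. For $L\in\mathbf{NExt}(\mathsf{S4})$, its $\Box$-variant is $L^\Box=\{\phi:\phi[\Box\overline p/\overline p]\in L\}$, where $\phi[\Box\overline p/\overline p]$ substitutes $\Box q$ for each proposition letter $q$. For a $\Box$-variant $L'$, $Schem(L')=\{\phi:\forall\overline\psi,\ \phi[\overline\psi/\overline p]\in L'\}$, with $\overline\psi$ ranging over substitutions of modal formulas for proposition letters. $L$ is $\Box$-maximal if for every $S\in\mathbf{NExt}(\mathsf{S4})$, $L^\Box=S^\Box$ implies $S\subseteq L$. -}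

module Defs where

open import Level using (Level; _⊔_; suc; 0ℓ)
open import Data.Bool using (Bool; true; false; not) renaming (_∧_ to _∧ᵇ_; _∨_ to _∨ᵇ_)
open import Data.List using (List; map; foldr)
open import Data.Nat using (ℕ)
open import Data.Product using (Σ; ∃; _×_; _,_; proj₁; proj₂)
open import Data.Sum using (_⊎_)
open import Function.Bundles using (_⇔_)
open import Function.Definitions using (Congruent; Injective; Surjective; Bijective)
open import Relation.Binary.Bundles using (Poset)
open import Relation.Binary.Lattice using (HeytingAlgebra; BooleanAlgebra)
open import Relation.Binary.PropositionalEquality as ≡ using (_≡_)
import Relation.Binary.Lattice.Properties.MeetSemilattice as MeetProperties
import Relation.Binary.Lattice.Properties.JoinSemilattice as JoinProperties
import Relation.Binary.Lattice.Properties.HeytingAlgebra as HeytingProperties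
open import Relation.Unary using (Pred; _⊆_; _≐_; _∩_; _∪_; ∁; U; ∅)

private
  variable
    c ℓ ℓ₁ ℓ₂ k m : Level

------------------------------------------------------------------------
-- Zorn's lemma, stated as a type because it is not provable here

ZornsLemma : ∀ ℓ → Set (suc ℓ)
ZornsLemma ℓ = (P : Poset ℓ ℓ ℓ) → let open Poset P in
  ((C : Pred Carrier ℓ) → (∀ {x y} → C x → C y → x ≤ y ⊎ y ≤ x) →
    ∃ λ u → ∀ {x} → C x → x ≤ u) →
  ∃ λ w → ∀ {x} → w ≤ x → x ≈ w

------------------------------------------------------------------------
-- S4-algebras

record S4Algebra c ℓ₁ ℓ₂ : Set (suc (c ⊔ ℓ₁ ⊔ ℓ₂)) where
  field
    booleanAlgebra : BooleanAlgebra c ℓ₁ ℓ₂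

  open BooleanAlgebra booleanAlgebra public

  infix 8 □_
  field
    □_     : Carrier → Carrier
    □-cong : Congruent _≈_ _≈_ □_
    □-⊤    : □ ⊤ ≈ ⊤
    □-∧    : ∀ x y → □ (x ∧ y) ≈ □ x ∧ □ y
    □-T    : ∀ x → □ x ≤ x
    □-4    : ∀ x → □ x ≤ □ □ x

  □-mono : ∀ {x y} → x ≤ y → □ x ≤ □ y
  □-mono {x} {y} x≤y =
    trans (reflexive (Eq.trans
            (□-cong (antisym (∧-greatest refl x≤y) (x∧y≤x x y))) (□-∧ x y)))
          (x∧y≤y _ _)

S4Alg : ∀ ℓ → Set (suc ℓ)
S4Alg ℓ = S4Algebra ℓ ℓ ℓ

HeytingAlg : ∀ ℓ → Set (suc ℓ)
HeytingAlg ℓ = HeytingAlgebra ℓ ℓ ℓ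

-- The Heyting algebra ℬ_□ of the elements a with a = □ a.
openAlgebra : S4Algebra c ℓ₁ ℓ₂ → HeytingAlgebra (c ⊔ ℓ₁) ℓ₁ ℓ₂
openAlgebra 𝓑 = record
  { Carrier = ∃ λ a → a ≈ □ a
  ; _≈_ = λ a b → proj₁ a ≈ proj₁ b
  ; _≤_ = λ a b → proj₁ a ≤ proj₁ b
  ; _∨_ = λ (a , a□) (b , b□) → a ∨ b ,
      antisym (∨-least (trans (reflexive a□) (□-mono (x≤x∨y a b)))
                       (trans (reflexive b□) (□-mono (y≤x∨y a b))))
              (□-T _)
  ; _∧_ = λ (a , a□) (b , b□) → a ∧ b ,
      Eq.trans (∧-cong a□ b□) (Eq.sym (□-∧ a b))
  ; _⇨_ = λ (a , _) (b , _) → □ (¬ a ∨ b) , antisym (□-4 _) (□-T _)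
  ; ⊤ = ⊤ , Eq.sym □-⊤
  ; ⊥ = ⊥ , antisym (minimum _) (□-T _)
  ; isHeytingAlgebra = record
    { isBoundedLattice = record
      { isLattice = record
        { isPartialOrder = record
          { isPreorder = record
            { isEquivalence = record { refl = Eq.refl ; sym = Eq.sym ; trans = Eq.trans }
            ; reflexive = reflexive
            ; trans = trans
            }
          ; antisym = antisym
          }
        ; supremum = λ (a , _) (b , _) →
            x≤x∨y a b , y≤x∨y a b , λ _ → ∨-least
        ; infimum = λ (a , _) (b , _) →
            x∧y≤x a b , x∧y≤y a b , λ _ → ∧-greatest
        }
      ; maximum = λ (a , _) → maximum a
      ; minimum = λ (a , _) → minimum a
      }
    ; exponential = λ (w , w□) (a , _) (b , _) →
        (λ w∧a≤b → trans (reflexive w□) (□-mono (transpose-⇨ w∧a≤b))) ,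
        (λ w≤ → transpose-∧ (trans w≤ (□-T _)))
    }
  }
  where
  open S4Algebra 𝓑
  open MeetProperties meetSemilattice using (∧-cong)

------------------------------------------------------------------------
-- Homomorphisms, products and the class operators ℍ, 𝕊, ℙ

record IsS4Homomorphism (A B : S4Alg ℓ)
    (f : S4Algebra.Carrier A → S4Algebra.Carrier B) : Set ℓ where
  private
    module A = S4Algebra A
    module B = S4Algebra B
  field
    cong  : Congruent A._≈_ B._≈_ f
    ∧-hom : ∀ x y → f (x A.∧ y) B.≈ f x B.∧ f y
    ∨-hom : ∀ x y → f (x A.∨ y) B.≈ f x B.∨ f y
    ¬-hom : ∀ x → f (A.¬ x) B.≈ B.¬ f x
    ⊤-hom : f A.⊤ B.≈ B.⊤
    ⊥-hom : f A.⊥ B.≈ B.⊥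
    □-hom : ∀ x → f (A.□ x) B.≈ B.□ f x

record IsHeytingHomomorphism (G H : HeytingAlg ℓ)
    (f : HeytingAlgebra.Carrier G → HeytingAlgebra.Carrier H) : Set ℓ where
  private
    module G = HeytingAlgebra G
    module H = HeytingAlgebra H
  field
    cong  : Congruent G._≈_ H._≈_ f
    ∧-hom : ∀ x y → f (x G.∧ y) H.≈ f x H.∧ f y
    ∨-hom : ∀ x y → f (x G.∨ y) H.≈ f x H.∨ f y
    ⇨-hom : ∀ x y → f (x G.⇨ y) H.≈ f x H.⇨ f y
    ⊤-hom : f G.⊤ H.≈ H.⊤
    ⊥-hom : f G.⊥ H.≈ H.⊥

_≅ᴴ_ : HeytingAlg ℓ → HeytingAlg ℓ → Set ℓ
G ≅ᴴ H = ∃ λ f → IsHeytingHomomorphism G H f × Bijective G._≈_ H._≈_ f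
  where
  module G = HeytingAlgebra G
  module H = HeytingAlgebra H

_≅_ _↣_ _↠_ : S4Alg ℓ → S4Alg ℓ → Set ℓ
A ≅ B = ∃ λ f → IsS4Homomorphism A B f × Bijective (S4Algebra._≈_ A) (S4Algebra._≈_ B) f
A ↣ B = ∃ λ f → IsS4Homomorphism A B f × Injective (S4Algebra._≈_ A) (S4Algebra._≈_ B) f
A ↠ B = ∃ λ f → IsS4Homomorphism A B f × Surjective (S4Algebra._≈_ A) (S4Algebra._≈_ B) f

∏ : (I : Set ℓ) → (I → S4Alg ℓ) → S4Alg ℓ
∏ I 𝓐 = record
  { booleanAlgebra = record
    { Carrier = ∀ i → A.Carrier i
    ; _≈_ = λ x y → ∀ i → A._≈_ i (x i) (y i)
    ; _≤_ = λ x y → ∀ i → A._≤_ i (x i) (y i)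
    ; _∨_ = λ x y i → A._∨_ i (x i) (y i)
    ; _∧_ = λ x y i → A._∧_ i (x i) (y i)
    ; ¬_ = λ x i → A.¬_ i (x i)
    ; ⊤ = A.⊤
    ; ⊥ = A.⊥
    ; isBooleanAlgebra = record { isHeytingAlgebra = record
      { isBoundedLattice = record
        { isLattice = record
          { isPartialOrder = record
            { isPreorder = record
              { isEquivalence = record
                { refl = λ i → A.Eq.refl i
                ; sym = λ p i → A.Eq.sym i (p i)
                ; trans = λ p q i → A.Eq.trans i (p i) (q i)
                }
              ; reflexive = λ p i → A.reflexive i (p i)
              ; trans = λ p q i → A.trans i (p i) (q i)
              }
            ; antisym = λ p q i → A.antisym i (p i) (q i)
            }
          ; supremum = λ x y →
              (λ i → A.x≤x∨y i (x i) (y i)) , (λ i → A.y≤x∨y i (x i) (y i)) ,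
              (λ _ p q i → A.∨-least i (p i) (q i))
          ; infimum = λ x y →
              (λ i → A.x∧y≤x i (x i) (y i)) , (λ i → A.x∧y≤y i (x i) (y i)) ,
              (λ _ p q i → A.∧-greatest i (p i) (q i))
          }
        ; maximum = λ x i → A.maximum i (x i)
        ; minimum = λ x i → A.minimum i (x i)
        }
      ; exponential = λ _ _ _ →
          (λ p i → A.transpose-⇨ i (p i)) , (λ p i → A.transpose-∧ i (p i))
      } }
    }
  ; □_ = λ x i → A.□_ i (x i)
  ; □-cong = λ p i → A.□-cong i (p i)
  ; □-⊤ = A.□-⊤
  ; □-∧ = λ x y i → A.□-∧ i (x i) (y i)
  ; □-T = λ x i → A.□-T i (x i)
  ; □-4 = λ x i → A.□-4 i (x i)
  }
  where module A i = S4Algebra (𝓐 i)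

ℍ 𝕊 ℙ : Pred (S4Alg ℓ) k → Pred (S4Alg ℓ) (suc ℓ ⊔ k)
ℍ 𝐊 A = ∃ λ B → 𝐊 B × (B ↠ A)
𝕊 𝐊 A = ∃ λ B → 𝐊 B × (A ↣ B)
ℙ {ℓ = ℓ} 𝐊 A = Σ (Set ℓ) λ I → ∃ λ (𝓑 : I → S4Alg ℓ) → (∀ i → 𝐊 (𝓑 i)) × (A ≅ ∏ I 𝓑)

record IsVariety (𝐊 : Pred (S4Alg ℓ) k) : Set (suc ℓ ⊔ k) where
  field
    ℍ-closed : ℍ 𝐊 ⊆ 𝐊
    𝕊-closed : 𝕊 𝐊 ⊆ 𝐊
    ℙ-closed : ℙ 𝐊 ⊆ 𝐊

------------------------------------------------------------------------
-- The Boolean envelope of a Heyting algebra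

record PrimeFilter (H : HeytingAlg ℓ) : Set (suc ℓ) where
  open HeytingAlgebra H
  field
    member  : Pred Carrier ℓ
    upward  : ∀ {a b} → a ≤ b → member a → member b
    ⊤-in    : member ⊤
    ∧-in    : ∀ {a b} → member a → member b → member (a ∧ b)
    ⊥-out   : ∁ member ⊥
    prime   : ∀ {a b} → member (a ∨ b) → member a ⊎ member b

module _ {a} {X : Set a} (A : BooleanAlgebra c ℓ₁ ℓ₂) where
  open BooleanAlgebra A

  -- Membership in the Boolean subalgebra of A generated by the image of η.
  data Generated (η : X → Carrier) : Pred Carrier (a ⊔ c ⊔ ℓ₁) where
    gen   : ∀ a → Generated η (η a)
    ∧-gen : ∀ {x y} → Generated η x → Generated η y → Generated η (x ∧ y)
    ∨-gen : ∀ {x y} → Generated η x → Generated η y → Generated η (x ∨ y)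
    ¬-gen : ∀ {x} → Generated η x → Generated η (¬ x)
    ⊤-gen : Generated η ⊤
    ⊥-gen : Generated η ⊥
    ≈-gen : ∀ {x y} → x ≈ y → Generated η x → Generated η y

-- `IsBooleanEnvelope H A` says that A is (an isomorphic copy of) B(H): an
-- S4-algebra whose Boolean reduct is, via ⟦_⟧, the subalgebra of the powerset
-- of the set of prime filters of H generated by the sets ⟦ η a ⟧ = {x : a ∈ x},
-- and whose □ is given on finite meets of ¬ c ∨ d, with c, d ∈ H, by the
-- corresponding meets of c ⇨ d.  These conditions fix A up to isomorphism.
-- That every H has such an A is not a constructive fact: it needs H to embed
-- into the powerset of its prime filters.
record IsBooleanEnvelope (H : HeytingAlg ℓ) (A : S4Alg ℓ) : Set (suc ℓ) where
  private
    module H = HeytingAlgebra H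
    module A = S4Algebra A
  field
    ⟦_⟧         : A.Carrier → Pred (PrimeFilter H) ℓ
    ⟦⟧-cong     : Congruent A._≈_ _≐_ ⟦_⟧
    ⟦⟧-inj      : Injective A._≈_ _≐_ ⟦_⟧
    ⟦∧⟧         : ∀ x y → ⟦ x A.∧ y ⟧ ≐ ⟦ x ⟧ ∩ ⟦ y ⟧
    ⟦∨⟧         : ∀ x y → ⟦ x A.∨ y ⟧ ≐ ⟦ x ⟧ ∪ ⟦ y ⟧
    ⟦¬⟧         : ∀ x → ⟦ A.¬ x ⟧ ≐ ∁ ⟦ x ⟧
    ⟦⊤⟧         : ⟦ A.⊤ ⟧ ≐ U
    ⟦⊥⟧         : ⟦ A.⊥ ⟧ ≐ ∅
    η           : H.Carrier → A.Carrier
    ⟦η⟧         : ∀ a → ⟦ η a ⟧ ≐ λ x → PrimeFilter.member x a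
    generated   : ∀ x → Generated A.booleanAlgebra η x
    □-envelope  : (cds : List (H.Carrier × H.Carrier)) →
      A.□ (foldr A._∧_ A.⊤ (map (λ (c , d) → A.¬ η c A.∨ η d) cds))
        A.≈ η (foldr H._∧_ H.⊤ (map (λ (c , d) → c H.⇨ d) cds))

-- Closed under isomorphism, since algebras carry a setoid equality and
-- propositional equality of algebras is not meaningful.
ρ : Pred (S4Alg ℓ) k → Pred (HeytingAlg ℓ) (suc ℓ ⊔ k)
ρ 𝐊 H = ∃ λ 𝓑 → 𝐊 𝓑 × (H ≅ᴴ openAlgebra 𝓑)

σ : Pred (HeytingAlg ℓ) k → Pred (S4Alg ℓ) (suc ℓ ⊔ k)
σ 𝐏 = ℍ (𝕊 (ℙ λ A → ∃ λ H → 𝐏 H × IsBooleanEnvelope H A))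

------------------------------------------------------------------------
-- Modal formulas and normal extensions of S4

infixr 7 _∧̇_
infixr 6 _∨̇_
infixr 5 _⊃_
infix 8 ¬̇_ □̇_

data Formula : Set where
  var       : ℕ → Formula
  ⊤̇ ⊥̇       : Formula
  ¬̇_ □̇_     : Formula → Formula
  _∧̇_ _∨̇_   : Formula → Formula → Formula

_⊃_ : Formula → Formula → Formula
φ ⊃ ψ = ¬̇ φ ∨̇ ψ

infix 9 _[_]
_[_] : Formula → (ℕ → Formula) → Formula
var n    [ s ] = s n
⊤̇        [ s ] = ⊤̇
⊥̇        [ s ] = ⊥̇
(¬̇ φ)    [ s ] = ¬̇ (φ [ s ])
(□̇ φ)    [ s ] = □̇ (φ [ s ])
(φ ∧̇ ψ)  [ s ] = φ [ s ] ∧̇ ψ [ s ]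
(φ ∨̇ ψ)  [ s ] = φ [ s ] ∨̇ ψ [ s ]

module _ (𝓑 : S4Algebra c ℓ₁ ℓ₂) where
  open S4Algebra 𝓑

  eval : (ℕ → Carrier) → Formula → Carrier
  eval v (var n)  = v n
  eval v ⊤̇        = ⊤
  eval v ⊥̇        = ⊥
  eval v (¬̇ φ)    = ¬ eval v φ
  eval v (□̇ φ)    = □ eval v φ
  eval v (φ ∧̇ ψ)  = eval v φ ∧ eval v ψ
  eval v (φ ∨̇ ψ)  = eval v φ ∨ eval v ψ

Log : Pred (S4Alg ℓ) k → Pred Formula (suc ℓ ⊔ k)
Log 𝐊 φ = ∀ 𝓑 → 𝐊 𝓑 → ∀ v → S4Algebra._≈_ 𝓑 (eval 𝓑 v φ) (S4Algebra.⊤ 𝓑)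

-- Truth value of a formula, with formulas □ φ treated as atoms.
truth : (Formula → Bool) → Formula → Bool
truth b (var n)  = b (var n)
truth b ⊤̇        = true
truth b ⊥̇        = false
truth b (¬̇ φ)    = not (truth b φ)
truth b (□̇ φ)    = b (□̇ φ)
truth b (φ ∧̇ ψ)  = truth b φ ∧ᵇ truth b ψ
truth b (φ ∨̇ ψ)  = truth b φ ∨ᵇ truth b ψ

Tautology : Pred Formula 0ℓ
Tautology φ = ∀ b → truth b φ ≡ true

data 𝖲𝟦 : Pred Formula 0ℓ where
  taut : ∀ {φ} → Tautology φ → 𝖲𝟦 φ
  ax-K : ∀ φ ψ → 𝖲𝟦 (□̇ (φ ⊃ ψ) ⊃ □̇ φ ⊃ □̇ ψ)
  ax-T : ∀ φ → 𝖲𝟦 (□̇ φ ⊃ φ)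
  ax-4 : ∀ φ → 𝖲𝟦 (□̇ φ ⊃ □̇ □̇ φ)
  mp   : ∀ {φ ψ} → 𝖲𝟦 (φ ⊃ ψ) → 𝖲𝟦 φ → 𝖲𝟦 ψ
  nec  : ∀ {φ} → 𝖲𝟦 φ → 𝖲𝟦 (□̇ φ)

record NExtS4 m : Set (suc m) where
  field
    theorems     : Pred Formula m
    extends      : 𝖲𝟦 ⊆ theorems
    mp-closed    : ∀ {φ ψ} → theorems (φ ⊃ ψ) → theorems φ → theorems ψ
    nec-closed   : ∀ {φ} → theorems φ → theorems (□̇ φ)
    subst-closed : ∀ {φ} s → theorems φ → theorems (φ [ s ])

open NExtS4 using (theorems)

------------------------------------------------------------------------
-- Intuitionistic formulas and superintuitionistic logics

infixr 7 _⩀_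
infixr 6 _⩁_
infixr 5 _⇒_

data IFormula : Set where
  var         : ℕ → IFormula
  ⊤ⁱ ⊥ⁱ       : IFormula
  _⩀_ _⩁_ _⇒_ : IFormula → IFormula → IFormula

infix 9 _[_]ⁱ
_[_]ⁱ : IFormula → (ℕ → IFormula) → IFormula
var n    [ s ]ⁱ = s n
⊤ⁱ       [ s ]ⁱ = ⊤ⁱ
⊥ⁱ       [ s ]ⁱ = ⊥ⁱ
(φ ⩀ ψ)  [ s ]ⁱ = φ [ s ]ⁱ ⩀ ψ [ s ]ⁱ
(φ ⩁ ψ)  [ s ]ⁱ = φ [ s ]ⁱ ⩁ ψ [ s ]ⁱ
(φ ⇒ ψ)  [ s ]ⁱ = φ [ s ]ⁱ ⇒ ψ [ s ]ⁱ

data 𝖨𝖯𝖢 : Pred IFormula 0ℓ where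
  ax-K  : ∀ φ ψ → 𝖨𝖯𝖢 (φ ⇒ ψ ⇒ φ)
  ax-S  : ∀ φ ψ χ → 𝖨𝖯𝖢 ((φ ⇒ ψ ⇒ χ) ⇒ (φ ⇒ ψ) ⇒ φ ⇒ χ)
  ax-∧ᵢ : ∀ φ ψ → 𝖨𝖯𝖢 (φ ⇒ ψ ⇒ φ ⩀ ψ)
  ax-∧₁ : ∀ φ ψ → 𝖨𝖯𝖢 (φ ⩀ ψ ⇒ φ)
  ax-∧₂ : ∀ φ ψ → 𝖨𝖯𝖢 (φ ⩀ ψ ⇒ ψ)
  ax-∨₁ : ∀ φ ψ → 𝖨𝖯𝖢 (φ ⇒ φ ⩁ ψ)
  ax-∨₂ : ∀ φ ψ → 𝖨𝖯𝖢 (ψ ⇒ φ ⩁ ψ)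
  ax-∨ₑ : ∀ φ ψ χ → 𝖨𝖯𝖢 ((φ ⇒ χ) ⇒ (ψ ⇒ χ) ⇒ φ ⩁ ψ ⇒ χ)
  ax-⊥  : ∀ φ → 𝖨𝖯𝖢 (⊥ⁱ ⇒ φ)
  ax-⊤  : 𝖨𝖯𝖢 ⊤ⁱ
  mp    : ∀ {φ ψ} → 𝖨𝖯𝖢 (φ ⇒ ψ) → 𝖨𝖯𝖢 φ → 𝖨𝖯𝖢 ψ

record ΛIPC m : Set (suc m) where
  field
    theorems     : Pred IFormula m
    extends      : 𝖨𝖯𝖢 ⊆ theorems
    mp-closed    : ∀ {φ ψ} → theorems (φ ⇒ ψ) → theorems φ → theorems ψ
    subst-closed : ∀ {φ} s → theorems φ → theorems (φ [ s ]ⁱ)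

GMT : IFormula → Formula
GMT (var n)  = □̇ var n
GMT ⊤ⁱ       = ⊤̇
GMT ⊥ⁱ       = ⊥̇
GMT (φ ⩀ ψ)  = GMT φ ∧̇ GMT ψ
GMT (φ ⩁ ψ)  = GMT φ ∨̇ GMT ψ
GMT (φ ⇒ ψ)  = □̇ (¬̇ GMT φ ∨̇ GMT ψ)

------------------------------------------------------------------------
-- {φ : GMT φ ∈ M} is a superintuitionistic logic

module _ (H : HeytingAlgebra c ℓ₁ ℓ₂) where
  open HeytingAlgebra H
  open HeytingProperties H using (y≤x⇨y; ⇨-eval; ∧-distribˡ-∨-≤; ⇨-cong)
  open MeetProperties meetSemilattice using (∧-cong)
  open JoinProperties joinSemilattice using (∨-cong)

  evalⁱ : (ℕ → Carrier) → IFormula → Carrier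
  evalⁱ v (var n)  = v n
  evalⁱ v ⊤ⁱ       = ⊤
  evalⁱ v ⊥ⁱ       = ⊥
  evalⁱ v (φ ⩀ ψ)  = evalⁱ v φ ∧ evalⁱ v ψ
  evalⁱ v (φ ⩁ ψ)  = evalⁱ v φ ∨ evalⁱ v ψ
  evalⁱ v (φ ⇒ ψ)  = evalⁱ v φ ⇨ evalⁱ v ψ

  evalⁱ-cong : ∀ {v w} → (∀ n → v n ≈ w n) → ∀ φ → evalⁱ v φ ≈ evalⁱ w φ
  evalⁱ-cong p (var n) = p n
  evalⁱ-cong p ⊤ⁱ      = Eq.refl
  evalⁱ-cong p ⊥ⁱ      = Eq.refl
  evalⁱ-cong p (φ ⩀ ψ) = ∧-cong (evalⁱ-cong p φ) (evalⁱ-cong p ψ)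
  evalⁱ-cong p (φ ⩁ ψ) = ∨-cong (evalⁱ-cong p φ) (evalⁱ-cong p ψ)
  evalⁱ-cong p (φ ⇒ ψ) = ⇨-cong (evalⁱ-cong p φ) (evalⁱ-cong p ψ)

  evalⁱ-subst : ∀ {v} s φ → evalⁱ v (φ [ s ]ⁱ) ≡ evalⁱ (λ n → evalⁱ v (s n)) φ
  evalⁱ-subst s (var n) = ≡.refl
  evalⁱ-subst s ⊤ⁱ      = ≡.refl
  evalⁱ-subst s ⊥ⁱ      = ≡.refl
  evalⁱ-subst s (φ ⩀ ψ) = ≡.cong₂ _∧_ (evalⁱ-subst s φ) (evalⁱ-subst s ψ)
  evalⁱ-subst s (φ ⩁ ψ) = ≡.cong₂ _∨_ (evalⁱ-subst s φ) (evalⁱ-subst s ψ)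
  evalⁱ-subst s (φ ⇒ ψ) = ≡.cong₂ _⇨_ (evalⁱ-subst s φ) (evalⁱ-subst s ψ)

  private
    intro : ∀ {x y} → x ≤ y → ⊤ ≤ x ⇨ y
    intro x≤y = transpose-⇨ (trans (x∧y≤y _ _) x≤y)

    app : ∀ {w x y} → w ≤ x ⇨ y → w ≤ x → w ≤ y
    app p q = trans (∧-greatest p q) ⇨-eval

  IPC-sound : ∀ {φ} → 𝖨𝖯𝖢 φ → ∀ v → ⊤ ≤ evalⁱ v φ
  IPC-sound (ax-K φ ψ) v = intro y≤x⇨y
  IPC-sound (ax-S φ ψ χ) v = intro (transpose-⇨ (transpose-⇨
    (app (app (trans (x∧y≤x _ _) (x∧y≤x _ _)) (x∧y≤y _ _))
         (app (trans (x∧y≤x _ _) (x∧y≤y _ _)) (x∧y≤y _ _)))))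
  IPC-sound (ax-∧ᵢ φ ψ) v = intro (transpose-⇨ refl)
  IPC-sound (ax-∧₁ φ ψ) v = intro (x∧y≤x _ _)
  IPC-sound (ax-∧₂ φ ψ) v = intro (x∧y≤y _ _)
  IPC-sound (ax-∨₁ φ ψ) v = intro (x≤x∨y _ _)
  IPC-sound (ax-∨₂ φ ψ) v = intro (y≤x∨y _ _)
  IPC-sound (ax-∨ₑ φ ψ χ) v = intro (transpose-⇨ (transpose-⇨
    (trans (∧-distribˡ-∨-≤ _ _ _)
      (∨-least (app (trans (x∧y≤x _ _) (x∧y≤x _ _)) (x∧y≤y _ _))
               (app (trans (x∧y≤x _ _) (x∧y≤y _ _)) (x∧y≤y _ _))))))
  IPC-sound (ax-⊥ φ) v = intro (minimum _)
  IPC-sound ax-⊤ v = refl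
  IPC-sound (mp p q) v = app (IPC-sound p v) (IPC-sound q v)

module _ (𝓑 : S4Algebra c ℓ₁ ℓ₂) where
  open S4Algebra 𝓑

  □-idem : ∀ x → □ x ≈ □ □ x
  □-idem x = antisym (□-4 x) (□-T _)

  private
    ¬-anti : ∀ {x y} → x ≤ y → ¬ y ≤ ¬ x
    ¬-anti {x} {y} x≤y = trans (transpose-⇨ {y = ⊥}
      (trans (∧-greatest (x∧y≤x _ _) (trans (x∧y≤y _ _) x≤y))
             (transpose-∧ {x = y} {y = ⊥} (x≤x∨y (¬ y) ⊥))))
      (∨-least refl (minimum _))

  eval-GMT : ∀ v φ →
    eval 𝓑 v (GMT φ) ≈ proj₁ (evalⁱ (openAlgebra 𝓑) (λ n → □ v n , □-idem (v n)) φ)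
  eval-GMT v (var n) = Eq.refl
  eval-GMT v ⊤ⁱ      = Eq.refl
  eval-GMT v ⊥ⁱ      = Eq.refl
  eval-GMT v (φ ⩀ ψ) = ∧-cong (eval-GMT v φ) (eval-GMT v ψ)
    where open MeetProperties meetSemilattice using (∧-cong)
  eval-GMT v (φ ⩁ ψ) = ∨-cong (eval-GMT v φ) (eval-GMT v ψ)
    where open JoinProperties joinSemilattice using (∨-cong)
  eval-GMT v (φ ⇒ ψ) = □-cong (∨-cong
    (antisym (¬-anti (reflexive (Eq.sym (eval-GMT v φ))))
             (¬-anti (reflexive (eval-GMT v φ))))
    (eval-GMT v ψ))
    where open JoinProperties joinSemilattice using (∨-cong)

module _ (M : NExtS4 m) where
  private
    module M = NExtS4 M

    infix 4 _≼_
    _≼_ : Formula → Formula → Set m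
    φ ≼ ψ = M.theorems (φ ⊃ ψ)

    tautology : ∀ {φ} → Tautology φ → M.theorems φ
    tautology t = M.extends (taut t)

    ⊃-refl : ∀ p → not p ∨ᵇ p ≡ true
    ⊃-refl true = ≡.refl
    ⊃-refl false = ≡.refl

    ⊃-weaken : ∀ p q → not q ∨ᵇ (not p ∨ᵇ q) ≡ true
    ⊃-weaken true true = ≡.refl
    ⊃-weaken true false = ≡.refl
    ⊃-weaken false true = ≡.refl
    ⊃-weaken false false = ≡.refl

    ⊃-trans : ∀ p q r → not (not p ∨ᵇ q) ∨ᵇ (not (not q ∨ᵇ r) ∨ᵇ (not p ∨ᵇ r)) ≡ true
    ⊃-trans false false _ = ≡.refl
    ⊃-trans false true true = ≡.refl
    ⊃-trans false true false = ≡.refl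
    ⊃-trans true false _ = ≡.refl
    ⊃-trans true true true = ≡.refl
    ⊃-trans true true false = ≡.refl

    ⊃-∨₁ : ∀ p q → not p ∨ᵇ (p ∨ᵇ q) ≡ true
    ⊃-∨₁ false _ = ≡.refl
    ⊃-∨₁ true _ = ≡.refl

    ⊃-∨₂ : ∀ p q → not q ∨ᵇ (p ∨ᵇ q) ≡ true
    ⊃-∨₂ _ false = ≡.refl
    ⊃-∨₂ false true = ≡.refl
    ⊃-∨₂ true true = ≡.refl

    ⊃-∨ₑ : ∀ p q r → not (not p ∨ᵇ r) ∨ᵇ (not (not q ∨ᵇ r) ∨ᵇ (not (p ∨ᵇ q) ∨ᵇ r)) ≡ true
    ⊃-∨ₑ true _ false = ≡.refl
    ⊃-∨ₑ true true true = ≡.refl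
    ⊃-∨ₑ true false true = ≡.refl
    ⊃-∨ₑ false true true = ≡.refl
    ⊃-∨ₑ false true false = ≡.refl
    ⊃-∨ₑ false false _ = ≡.refl

    ⊃-∧₁ : ∀ p q → not (p ∧ᵇ q) ∨ᵇ p ≡ true
    ⊃-∧₁ false _ = ≡.refl
    ⊃-∧₁ true false = ≡.refl
    ⊃-∧₁ true true = ≡.refl

    ⊃-∧₂ : ∀ p q → not (p ∧ᵇ q) ∨ᵇ q ≡ true
    ⊃-∧₂ false _ = ≡.refl
    ⊃-∧₂ true false = ≡.refl
    ⊃-∧₂ true true = ≡.refl

    ⊃-∧ᵢ : ∀ p q r → not (not r ∨ᵇ p) ∨ᵇ (not (not r ∨ᵇ q) ∨ᵇ (not r ∨ᵇ (p ∧ᵇ q))) ≡ true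
    ⊃-∧ᵢ _ _ false = ≡.refl
    ⊃-∧ᵢ true true true = ≡.refl
    ⊃-∧ᵢ true false true = ≡.refl
    ⊃-∧ᵢ false _ true = ≡.refl

    ⊃-⊤ : ∀ p → not p ∨ᵇ true ≡ true
    ⊃-⊤ true = ≡.refl
    ⊃-⊤ false = ≡.refl

    ⊃-curry : ∀ p q r → not (not (p ∧ᵇ q) ∨ᵇ r) ∨ᵇ (not p ∨ᵇ (not q ∨ᵇ r)) ≡ true
    ⊃-curry false _ _ = ≡.refl
    ⊃-curry true false _ = ≡.refl
    ⊃-curry true true true = ≡.refl
    ⊃-curry true true false = ≡.refl

    ⊃-uncurry : ∀ p q r → not (not p ∨ᵇ (not q ∨ᵇ r)) ∨ᵇ (not (p ∧ᵇ q) ∨ᵇ r) ≡ true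
    ⊃-uncurry false _ _ = ≡.refl
    ⊃-uncurry true false _ = ≡.refl
    ⊃-uncurry true true true = ≡.refl
    ⊃-uncurry true true false = ≡.refl

    ≼-refl : ∀ φ → φ ≼ φ
    ≼-refl φ = tautology λ b → ⊃-refl (truth b φ)

    ≼-trans : ∀ {φ ψ χ} → φ ≼ ψ → ψ ≼ χ → φ ≼ χ
    ≼-trans {φ} {ψ} {χ} p q = M.mp-closed (M.mp-closed
      (tautology λ b → ⊃-trans (truth b φ) (truth b ψ) (truth b χ)) p) q

    ∧-glb : ∀ {φ ψ χ} → χ ≼ φ → χ ≼ ψ → χ ≼ φ ∧̇ ψ
    ∧-glb {φ} {ψ} {χ} p q = M.mp-closed (M.mp-closed
      (tautology λ b → ⊃-∧ᵢ (truth b φ) (truth b ψ) (truth b χ)) p) q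

    uncurry : ∀ {φ ψ χ} → φ ≼ (ψ ⊃ χ) → φ ∧̇ ψ ≼ χ
    uncurry {φ} {ψ} {χ} =
      M.mp-closed (tautology λ b → ⊃-uncurry (truth b φ) (truth b ψ) (truth b χ))

    curry : ∀ {φ ψ χ} → φ ∧̇ ψ ≼ χ → φ ≼ (ψ ⊃ χ)
    curry {φ} {ψ} {χ} =
      M.mp-closed (tautology λ b → ⊃-curry (truth b φ) (truth b ψ) (truth b χ))

    □-≼ : ∀ {φ ψ} → φ ≼ ψ → □̇ φ ≼ □̇ ψ
    □-≼ p = M.mp-closed (M.extends (ax-K _ _)) (M.nec-closed p)

    ∧-≼₁ : ∀ φ ψ → φ ∧̇ ψ ≼ φ
    ∧-≼₁ φ ψ = tautology λ b → ⊃-∧₁ (truth b φ) (truth b ψ)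

    ∧-≼₂ : ∀ φ ψ → φ ∧̇ ψ ≼ ψ
    ∧-≼₂ φ ψ = tautology λ b → ⊃-∧₂ (truth b φ) (truth b ψ)

    weaken : ∀ {φ ψ} → M.theorems φ → ψ ≼ φ
    weaken {φ} {ψ} = M.mp-closed (tautology λ b → ⊃-weaken (truth b ψ) (truth b φ))

  lindenbaum : S4Algebra 0ℓ m m
  lindenbaum = record
    { booleanAlgebra = record
      { Carrier = Formula
      ; _≈_ = λ φ ψ → φ ≼ ψ × ψ ≼ φ
      ; _≤_ = _≼_
      ; _∨_ = _∨̇_
      ; _∧_ = _∧̇_
      ; ¬_ = ¬̇_
      ; ⊤ = ⊤̇
      ; ⊥ = ⊥̇
      ; isBooleanAlgebra = record { isHeytingAlgebra = record
        { isBoundedLattice = record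
          { isLattice = record
            { isPartialOrder = record
              { isPreorder = record
                { isEquivalence = record
                  { refl = ≼-refl _ , ≼-refl _
                  ; sym = λ (p , q) → q , p
                  ; trans = λ (p , q) (r , s) → ≼-trans p r , ≼-trans s q
                  }
                ; reflexive = proj₁
                ; trans = ≼-trans
                }
              ; antisym = _,_
              }
            ; supremum = λ φ ψ →
                (tautology λ b → ⊃-∨₁ (truth b φ) (truth b ψ)) ,
                (tautology λ b → ⊃-∨₂ (truth b φ) (truth b ψ)) ,
                λ χ p q → M.mp-closed (M.mp-closed
                  (tautology λ b → ⊃-∨ₑ (truth b φ) (truth b ψ) (truth b χ)) p) q
            ; infimum = λ φ ψ → ∧-≼₁ φ ψ , ∧-≼₂ φ ψ , λ _ → ∧-glb
            }
          ; maximum = λ φ → tautology λ b → ⊃-⊤ (truth b φ)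
          ; minimum = λ φ → tautology λ b → ≡.refl
          }
        ; exponential = λ _ _ _ → curry , uncurry
        } }
      }
    ; □_ = □̇_
    ; □-cong = λ (p , q) → □-≼ p , □-≼ q
    ; □-⊤ = (tautology λ b → ⊃-⊤ (b (□̇ ⊤̇))) , weaken (M.nec-closed (tautology λ _ → ≡.refl))
    ; □-∧ = λ φ ψ →
        ∧-glb (□-≼ (∧-≼₁ φ ψ)) (□-≼ (∧-≼₂ φ ψ)) ,
        uncurry (≼-trans (□-≼ (curry (≼-refl (φ ∧̇ ψ)))) (M.extends (ax-K _ _)))
    ; □-T = λ φ → M.extends (ax-T φ)
    ; □-4 = λ φ → M.extends (ax-4 φ)
    }

  private
    module L = S4Algebra lindenbaum

    H : HeytingAlgebra m m m
    H = openAlgebra lindenbaum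

    eval-[] : ∀ s φ → eval lindenbaum s φ ≡ φ [ s ]
    eval-[] s (var n) = ≡.refl
    eval-[] s ⊤̇       = ≡.refl
    eval-[] s ⊥̇       = ≡.refl
    eval-[] s (¬̇ φ)   = ≡.cong ¬̇_ (eval-[] s φ)
    eval-[] s (□̇ φ)   = ≡.cong □̇_ (eval-[] s φ)
    eval-[] s (φ ∧̇ ψ) = ≡.cong₂ _∧̇_ (eval-[] s φ) (eval-[] s ψ)
    eval-[] s (φ ∨̇ ψ) = ≡.cong₂ _∨̇_ (eval-[] s φ) (eval-[] s ψ)

    □val : (ℕ → Formula) → ℕ → HeytingAlgebra.Carrier H
    □val s n = □̇ s n , □-idem lindenbaum (s n)

    eval-var : ∀ φ → φ ≡ φ [ var ]
    eval-var (var n) = ≡.refl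
    eval-var ⊤̇       = ≡.refl
    eval-var ⊥̇       = ≡.refl
    eval-var (¬̇ φ)   = ≡.cong ¬̇_ (eval-var φ)
    eval-var (□̇ φ)   = ≡.cong □̇_ (eval-var φ)
    eval-var (φ ∧̇ ψ) = ≡.cong₂ _∧̇_ (eval-var φ) (eval-var ψ)
    eval-var (φ ∨̇ ψ) = ≡.cong₂ _∨̇_ (eval-var φ) (eval-var ψ)

    GMT-value : ∀ s φ → GMT φ [ s ] L.≈ proj₁ (evalⁱ H (□val s) φ)
    GMT-value s φ = ≡.subst (λ ψ → ψ L.≈ proj₁ (evalⁱ H (□val s) φ))
      (eval-[] s (GMT φ)) (eval-GMT lindenbaum s φ)

    GMT-value-var : ∀ φ → GMT φ L.≈ proj₁ (evalⁱ H (□val var) φ)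
    GMT-value-var φ = ≡.subst (λ ψ → ψ L.≈ proj₁ (evalⁱ H (□val var) φ))
      (≡.sym (eval-var (GMT φ))) (GMT-value var φ)

    GMT-subst : ∀ s φ → GMT φ [ (λ n → GMT (s n)) ] L.≈ GMT (φ [ s ]ⁱ)
    GMT-subst s φ = L.Eq.trans (GMT-value (λ n → GMT (s n)) φ) (L.Eq.trans
      (evalⁱ-cong H {v = □val (λ n → GMT (s n))} {w = λ n → evalⁱ H (□val var) (s n)}
        (λ n → L.Eq.trans (L.□-cong (GMT-value-var (s n)))
                 (L.Eq.sym (proj₂ (evalⁱ H (□val var) (s n))))) φ)
      (≡.subst (λ x → proj₁ x L.≈ GMT (φ [ s ]ⁱ)) (evalⁱ-subst H s φ)
        (L.Eq.sym (GMT-value-var (φ [ s ]ⁱ)))))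

  ρᴸ : ΛIPC m
  ρᴸ = record
    { theorems = λ φ → M.theorems (GMT φ)
    ; extends = λ {φ} p → M.mp-closed
        (≼-trans (IPC-sound H p (□val var)) (proj₂ (GMT-value-var φ)))
        (tautology λ _ → ≡.refl)
    ; mp-closed = λ p q → M.mp-closed (M.mp-closed (M.extends (ax-T _)) p) q
    ; subst-closed = λ {φ} s p →
        M.mp-closed (proj₁ (GMT-subst s φ)) (M.subst-closed (λ n → GMT (s n)) p)
    }

------------------------------------------------------------------------
-- Modal companions, □-variants, schematic fragments, □-maximality

IsModalCompanion : NExtS4 m → ΛIPC m → Set m
IsModalCompanion M L = ∀ φ → ΛIPC.theorems L φ ⇔ theorems M (GMT φ)

record IsGreatestModalCompanion (M : NExtS4 m) (L : ΛIPC m) : Set (suc m) where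
  field
    isModalCompanion : IsModalCompanion M L
    greatest         : ∀ N → IsModalCompanion N L → theorems N ⊆ theorems M

infix 10 _^□
_^□ : Pred Formula m → Pred Formula m
(L ^□) φ = L (φ [ (λ q → □̇ var q) ])

Schem : Pred Formula m → Pred Formula m
Schem L′ φ = ∀ s → L′ (φ [ s ])

□-Maximal : NExtS4 m → Set (suc m)
□-Maximal L = ∀ S → theorems L ^□ ≐ theorems S ^□ → theorems S ⊆ theorems L

-- A formula whose variables take open values is equivalent to a meet of clauses
-- ¬ c ∨ d with c, d open, and □ turns that meet into the Heyting term ⋀ (c ⇨ d),
-- which depends only on the algebra of open elements. So over open values
-- validity of φ is the validity of one intuitionistic term, the same in 𝓑, in
-- B(𝓑_□) and, taking GMT φ for the open values, in the Lindenbaum algebra of a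
-- logic. For the latter this says that L^□ and {φ : GMT φ ∈ L} determine each
-- other. For the former, every element of B(H) is a Boolean term in elements of H,
-- which makes Schem (Log 𝐊 ^□) valid in B(H); conversely B(𝓑_□) is the
-- subalgebra of 𝓑 generated by 𝓑_□, where the values □ v live.

module Submission where

open import Defs
open import Axiom.ExcludedMiddle using (ExcludedMiddle)
open import Data.Product using (_×_)
open import Function.Bundles using (_⇔_)
open import Level using (suc)
open import Relation.Unary using (Pred; _≐_)

open import Algebra.Bundles using (CommutativeSemigroup)
open import Algebra.Lattice.Bundles using () renaming (BooleanAlgebra to AlgebraicBooleanAlgebra)
import Algebra.Lattice.Properties.BooleanAlgebra as AlgebraicBooleanProperties
import Algebra.Properties.CommutativeSemigroup as CommutativeSemigroupProperties
open import Algebra.Structures using (IsCommutativeMonoid)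
open import Data.Bool using (true; false; not) renaming (_∨_ to _∨ᵇ_)
open import Data.Empty using (⊥-elim) renaming (⊥ to Empty)
open import Data.List using (List; []; _∷_; _++_; map; foldr; cartesianProductWith)
open import Data.Nat as ℕ using (ℕ; _+_)
open import Data.Nat.Properties using (+-identityʳ; +-suc)
open import Data.Product using (∃; _,_; proj₁; proj₂)
open import Data.Sum as Sum using (_⊎_; inj₁; inj₂; [_,_]′)
open import Data.Unit using () renaming (⊤ to Unit)
open import Function using (_∘_; id)
open import Function.Bundles using (mk⇔; Equivalence)
open import Function.Construct.Composition using (_⇔-∘_)
open import Function.Construct.Identity using (⇔-id)
open import Function.Construct.Symmetry using (⇔-sym)
open import Level using (Level; Lift; lift; lower; _⊔_)
open import Relation.Binary.Bundles using (Poset)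
open import Relation.Binary.Lattice using (HeytingAlgebra; BooleanAlgebra)
import Relation.Binary.Lattice.Properties.DistributiveLattice as DistributiveLatticeProperties
import Relation.Binary.Lattice.Properties.HeytingAlgebra as HeytingProperties
import Relation.Binary.Lattice.Properties.Lattice as LatticeProperties
open import Relation.Binary.PropositionalEquality as ≡ using (_≡_)
import Relation.Binary.Reasoning.Setoid as ≈-Reasoning
open import Relation.Nullary.Decidable
  using (Dec; yes; no; True; toWitness; fromWitness; map′; decidable-stable)
open import Relation.Unary using (_⊆_)

private
  variable
    a c ℓ ℓ₁ ℓ₂ k m : Level

-- Boolean algebra in order-theoretic form

module BooleanProperties (B : BooleanAlgebra c ℓ₁ ℓ₂) where
  open BooleanAlgebra B
  open HeytingProperties heytingAlgebra using (⇨-unit; ⇨-cong; distributiveLattice)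
  open DistributiveLatticeProperties distributiveLattice
  open LatticeProperties lattice using (isAlgLattice)

  ∨-⊥ : ∀ x → x ∨ ⊥ ≈ x
  ∨-⊥ x = antisym (∨-least refl (minimum x)) (x≤x∨y x ⊥)

  x∧¬x≤⊥ : ∀ {x} → x ∧ ¬ x ≤ ⊥
  x∧¬x≤⊥ {x} = trans (∧-greatest (x∧y≤y _ _) (x∧y≤x _ _)) (transpose-∧ (x≤x∨y (¬ x) ⊥))

  algebraicBooleanAlgebra : AlgebraicBooleanAlgebra c ℓ₁
  algebraicBooleanAlgebra = record
    { isBooleanAlgebra = record
      { isDistributiveLattice = record
        { isLattice = isAlgLattice
        ; ∨-distrib-∧ = ∨-distrib-∧
        ; ∧-distrib-∨ = ∧-distrib-∨
        }
      ; ∨-complement = (λ _ → ⇨-unit) ,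
          (λ x → Eq.trans (antisym (∨-least (y≤x∨y _ _) (x≤x∨y _ _))
                                   (∨-least (y≤x∨y _ _) (x≤x∨y _ _))) ⇨-unit)
      ; ∧-complement =
          (λ x → antisym (trans (∧-greatest (x∧y≤y _ _) (x∧y≤x _ _)) x∧¬x≤⊥) (minimum _)) ,
          (λ x → antisym x∧¬x≤⊥ (minimum _))
      -- `¬ x` is recovered as `x ⇨ ⊥`, that is `¬ x ∨ ⊥`, so congruence of `⇨` applies.
      ; ¬-cong = λ x≈y → Eq.trans (Eq.sym (∨-⊥ _)) (Eq.trans (⇨-cong x≈y Eq.refl) (∨-⊥ _))
      }
    }

  open AlgebraicBooleanAlgebra algebraicBooleanAlgebra public
    using (∧-cong; ∨-cong; ¬-cong; ∧-assoc; ∨-distribˡ-∧; ∨-distribʳ-∧)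
  open AlgebraicBooleanProperties algebraicBooleanAlgebra public
    using (¬-involutive; deMorgan₁; deMorgan₂; ¬⊤≈⊥; ¬⊥≈⊤; ∧-identityʳ; ∧-identityˡ;
           ∨-identityˡ; ∨-zeroʳ; ∨-zeroˡ; ∨-⊥-isCommutativeMonoid)

  ∨-commutativeSemigroup : CommutativeSemigroup c ℓ₁
  ∨-commutativeSemigroup = record
    { isCommutativeSemigroup =
        IsCommutativeMonoid.isCommutativeSemigroup ∨-⊥-isCommutativeMonoid
    }

  open CommutativeSemigroupProperties ∨-commutativeSemigroup public
    using () renaming (interchange to ∨-interchange)

  x∧¬y≤z⇒x≤y∨z : ∀ {x y z} → x ∧ ¬ y ≤ z → x ≤ y ∨ z
  x∧¬y≤z⇒x≤y∨z p =
    trans (transpose-⇨ p) (reflexive (∨-cong (¬-involutive _) Eq.refl))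

  x≤y∨z⇒x∧¬y≤z : ∀ {x y z} → x ≤ y ∨ z → x ∧ ¬ y ≤ z
  x≤y∨z⇒x∧¬y≤z p =
    transpose-∧ (trans p (reflexive (∨-cong (Eq.sym (¬-involutive _)) Eq.refl)))

  x∧y≤⊥⇒x≤¬y : ∀ {x y} → x ∧ y ≤ ⊥ → x ≤ ¬ y
  x∧y≤⊥⇒x≤¬y p = trans (transpose-⇨ p) (reflexive (∨-⊥ _))

  ¬-anti : ∀ {x y} → x ≤ y → ¬ y ≤ ¬ x
  ¬-anti x≤y = x∧y≤⊥⇒x≤¬y (trans (∧-greatest (trans (x∧y≤y _ _) x≤y) (x∧y≤x _ _)) x∧¬x≤⊥)

  x∧¬y≤⊥⇒x≤y : ∀ {x y} → x ∧ ¬ y ≤ ⊥ → x ≤ y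
  x∧¬y≤⊥⇒x≤y p = trans (x∧¬y≤z⇒x≤y∨z p) (reflexive (∨-⊥ _))

-- Conjunctive normal forms over an algebra of open elements

-- Operations without laws or equality, so that intuitionistic formulas themselves form an instance
-- besides every Heyting algebra.
record RawHeyting a : Set (suc a) where
  infixr 5 _⇨_
  infixr 6 _∨_
  infixr 7 _∧_
  field
    Carrier     : Set a
    _∧_ _∨_ _⇨_ : Carrier → Carrier → Carrier
    ⊤ ⊥         : Carrier

rawHeyting : HeytingAlgebra c ℓ₁ ℓ₂ → RawHeyting c
rawHeyting H = record { HeytingAlgebra H }

module CNF (H : RawHeyting a) where
  open RawHeyting H

  -- A list of pairs (c , d) stands for the meet of the clauses ¬ c ∨ d.
  Cnf : Set a
  Cnf = List (Carrier × Carrier)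

  infixr 6 _⊗_
  -- The join of two normal forms by distributivity: `(¬ c ∨ d) ∨ (¬ c′ ∨ d′)` is again one clause,
  -- `¬ (c ∧ c′) ∨ (d ∨ d′)`.
  _⊗_ : Cnf → Cnf → Cnf
  _⊗_ = cartesianProductWith λ (c , d) (c′ , d′) → c ∧ c′ , d ∨ d′

  reflect : Cnf → Carrier
  reflect cds = foldr _∧_ ⊤ (map (λ (c , d) → c ⇨ d) cds)

  -- Normal forms of a formula and of its negation, built together so that negation merely swaps
  -- them. Under `□̇` the whole normal form collapses to a single element of `H`, which removes
  -- nested boxes.
  cnf⁺ cnf⁻ : (ℕ → Carrier) → Formula → Cnf
  cnf⁺ u (var n)  = (⊤ , u n) ∷ []
  cnf⁺ u ⊤̇        = []
  cnf⁺ u ⊥̇        = (⊤ , ⊥) ∷ []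
  cnf⁺ u (¬̇ φ)    = cnf⁻ u φ
  cnf⁺ u (□̇ φ)    = (⊤ , reflect (cnf⁺ u φ)) ∷ []
  cnf⁺ u (φ ∧̇ ψ)  = cnf⁺ u φ ++ cnf⁺ u ψ
  cnf⁺ u (φ ∨̇ ψ)  = cnf⁺ u φ ⊗ cnf⁺ u ψ
  cnf⁻ u (var n)  = (u n , ⊥) ∷ []
  cnf⁻ u ⊤̇        = (⊤ , ⊥) ∷ []
  cnf⁻ u ⊥̇        = []
  cnf⁻ u (¬̇ φ)    = cnf⁺ u φ
  cnf⁻ u (□̇ φ)    = (reflect (cnf⁺ u φ) , ⊥) ∷ []
  cnf⁻ u (φ ∧̇ ψ)  = cnf⁻ u φ ⊗ cnf⁻ u ψ
  cnf⁻ u (φ ∨̇ ψ)  = cnf⁻ u φ ++ cnf⁻ u ψ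

-- Common form of `GMT` into a Lindenbaum algebra, of `η` into a Boolean envelope, and of the
-- inclusion of open elements.
record IsOpenInterpretation (H : RawHeyting a) (𝓑 : S4Algebra c ℓ₁ ℓ₂)
    (η : RawHeyting.Carrier H → S4Algebra.Carrier 𝓑) : Set (a ⊔ c ⊔ ℓ₁) where
  private
    module H = RawHeyting H
  open S4Algebra 𝓑
  field
    ∧-hom : ∀ x y → η (x H.∧ y) ≈ η x ∧ η y
    ∨-hom : ∀ x y → η (x H.∨ y) ≈ η x ∨ η y
    ⇨-hom : ∀ x y → η (x H.⇨ y) ≈ □ (¬ η x ∨ η y)
    ⊤-hom : η H.⊤ ≈ ⊤
    ⊥-hom : η H.⊥ ≈ ⊥

module OpenInterpretation {H : RawHeyting a} {𝓑 : S4Algebra c ℓ₁ ℓ₂}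
    {η : RawHeyting.Carrier H → S4Algebra.Carrier 𝓑} (int : IsOpenInterpretation H 𝓑 η) where
  private
    module H = RawHeyting H
  open IsOpenInterpretation int
  open S4Algebra 𝓑
  open BooleanProperties booleanAlgebra
  open CNF H
  open ≈-Reasoning setoid

  clause : H.Carrier × H.Carrier → Carrier
  clause (c , d) = ¬ η c ∨ η d

  value : Cnf → Carrier
  value cds = foldr _∧_ ⊤ (map clause cds)

  value-++ : ∀ xs ys → value (xs ++ ys) ≈ value xs ∧ value ys
  value-++ [] ys       = Eq.sym (∧-identityˡ _)
  value-++ (x ∷ xs) ys = begin
    clause x ∧ value (xs ++ ys)        ≈⟨ ∧-cong Eq.refl (value-++ xs ys) ⟩
    clause x ∧ (value xs ∧ value ys)   ≈⟨ ∧-assoc _ _ _ ⟨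
    (clause x ∧ value xs) ∧ value ys   ∎

  clause-∨ : ∀ c d c′ d′ →
    clause (c H.∧ c′ , d H.∨ d′) ≈ clause (c , d) ∨ clause (c′ , d′)
  clause-∨ c d c′ d′ = begin
    ¬ η (c H.∧ c′) ∨ η (d H.∨ d′)        ≈⟨ ∨-cong (¬-cong (∧-hom _ _)) (∨-hom _ _) ⟩
    ¬ (η c ∧ η c′) ∨ (η d ∨ η d′)        ≈⟨ ∨-cong (deMorgan₁ _ _) Eq.refl ⟩
    (¬ η c ∨ ¬ η c′) ∨ (η d ∨ η d′)      ≈⟨ ∨-interchange _ _ _ _ ⟩
    (¬ η c ∨ η d) ∨ (¬ η c′ ∨ η d′)      ∎

  value-map : ∀ c d ys →
    value (map (λ (c′ , d′) → c H.∧ c′ , d H.∨ d′) ys) ≈ clause (c , d) ∨ value ys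
  value-map c d []       = Eq.sym (∨-zeroʳ _)
  value-map c d ((c′ , d′) ∷ ys) = begin
    _                                                         ≈⟨ ∧-cong (clause-∨ c d c′ d′) (value-map c d ys) ⟩
    (clause (c , d) ∨ clause (c′ , d′)) ∧ (clause (c , d) ∨ value ys) ≈⟨ ∨-distribˡ-∧ _ _ _ ⟨
    clause (c , d) ∨ (clause (c′ , d′) ∧ value ys)            ∎

  value-⊗ : ∀ xs ys → value (xs ⊗ ys) ≈ value xs ∨ value ys
  value-⊗ [] ys             = Eq.sym (∨-zeroˡ _)
  value-⊗ ((c , d) ∷ xs) ys = begin
    _                                                 ≈⟨ value-++ (map _ ys) (xs ⊗ ys) ⟩
    _                                                 ≈⟨ ∧-cong (value-map c d ys) (value-⊗ xs ys) ⟩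
    (clause (c , d) ∨ value ys) ∧ (value xs ∨ value ys) ≈⟨ ∨-distribʳ-∧ _ _ _ ⟨
    (clause (c , d) ∧ value xs) ∨ value ys            ∎

  -- `□` distributes over finite meets, and `□` of a single clause is the image of a Heyting
  -- implication.
  □-value : ∀ cds → □ value cds ≈ η (reflect cds)
  □-value []              = Eq.trans □-⊤ (Eq.sym ⊤-hom)
  □-value ((c , d) ∷ cds) = begin
    □ (clause (c , d) ∧ value cds)          ≈⟨ □-∧ _ _ ⟩
    □ clause (c , d) ∧ □ value cds          ≈⟨ ∧-cong (Eq.sym (⇨-hom c d)) (□-value cds) ⟩
    η (c H.⇨ d) ∧ η (reflect cds)           ≈⟨ ∧-hom _ _ ⟨
    η ((c H.⇨ d) H.∧ reflect cds)           ∎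

  value-positive : ∀ d → value ((H.⊤ , d) ∷ []) ≈ η d
  value-positive d = begin
    (¬ η H.⊤ ∨ η d) ∧ ⊤   ≈⟨ ∧-identityʳ _ ⟩
    ¬ η H.⊤ ∨ η d         ≈⟨ ∨-cong (Eq.trans (¬-cong ⊤-hom) ¬⊤≈⊥) Eq.refl ⟩
    ⊥ ∨ η d               ≈⟨ ∨-identityˡ _ ⟩
    η d                   ∎

  value-negative : ∀ c → value ((c , H.⊥) ∷ []) ≈ ¬ η c
  value-negative c = begin
    (¬ η c ∨ η H.⊥) ∧ ⊤   ≈⟨ ∧-identityʳ _ ⟩
    ¬ η c ∨ η H.⊥         ≈⟨ ∨-cong Eq.refl ⊥-hom ⟩
    ¬ η c ∨ ⊥             ≈⟨ ∨-⊥ _ ⟩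
    ¬ η c                 ∎

  module _ (u : ℕ → H.Carrier) where

    value-cnf⁺ : ∀ φ → value (cnf⁺ u φ) ≈ eval 𝓑 (η ∘ u) φ
    value-cnf⁻ : ∀ φ → value (cnf⁻ u φ) ≈ ¬ eval 𝓑 (η ∘ u) φ
    value-cnf⁺ (var n) = value-positive _
    value-cnf⁺ ⊤̇       = Eq.refl
    value-cnf⁺ ⊥̇       = Eq.trans (value-positive _) ⊥-hom
    value-cnf⁺ (¬̇ φ)   = value-cnf⁻ φ
    value-cnf⁺ (□̇ φ)   = Eq.trans (value-positive _)
      (Eq.trans (Eq.sym (□-value (cnf⁺ u φ))) (□-cong (value-cnf⁺ φ)))
    value-cnf⁺ (φ ∧̇ ψ) = Eq.trans (value-++ (cnf⁺ u φ) (cnf⁺ u ψ))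
      (∧-cong (value-cnf⁺ φ) (value-cnf⁺ ψ))
    value-cnf⁺ (φ ∨̇ ψ) = Eq.trans (value-⊗ (cnf⁺ u φ) (cnf⁺ u ψ))
      (∨-cong (value-cnf⁺ φ) (value-cnf⁺ ψ))
    value-cnf⁻ (var n) = value-negative _
    value-cnf⁻ ⊤̇       = Eq.trans (value-negative _) (¬-cong ⊤-hom)
    value-cnf⁻ ⊥̇       = Eq.sym ¬⊥≈⊤
    value-cnf⁻ (¬̇ φ)   = Eq.trans (value-cnf⁺ φ) (Eq.sym (¬-involutive _))
    value-cnf⁻ (□̇ φ)   = Eq.trans (value-negative _)
      (¬-cong (Eq.trans (Eq.sym (□-value (cnf⁺ u φ))) (□-cong (value-cnf⁺ φ))))
    value-cnf⁻ (φ ∧̇ ψ) = Eq.trans (value-⊗ (cnf⁻ u φ) (cnf⁻ u ψ))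
      (Eq.trans (∨-cong (value-cnf⁻ φ) (value-cnf⁻ ψ)) (Eq.sym (deMorgan₁ _ _)))
    value-cnf⁻ (φ ∨̇ ψ) = Eq.trans (value-++ (cnf⁻ u φ) (cnf⁻ u ψ))
      (Eq.trans (∧-cong (value-cnf⁻ φ) (value-cnf⁻ ψ)) (Eq.sym (deMorgan₂ _ _)))

    □-eval : ∀ φ → □ eval 𝓑 (η ∘ u) φ ≈ η (reflect (cnf⁺ u φ))
    □-eval φ = Eq.trans (□-cong (Eq.sym (value-cnf⁺ φ))) (□-value (cnf⁺ u φ))

    -- An element equals `⊤` iff its `□` does, by `□ ⊤ ≈ ⊤` and `□ x ≤ x`; here the `□` is the image
    -- of one element of `H`.
    valid⇔reflect : ∀ φ → eval 𝓑 (η ∘ u) φ ≈ ⊤ ⇔ η (reflect (cnf⁺ u φ)) ≈ ⊤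
    valid⇔reflect φ = mk⇔
      (λ p → Eq.trans (Eq.sym (□-eval φ)) (Eq.trans (□-cong p) □-⊤))
      (λ p → antisym (maximum _)
        (trans (reflexive (Eq.sym (Eq.trans (□-eval φ) p))) (□-T _)))

-- Evaluation under congruence and substitution

module _ (𝓑 : S4Algebra c ℓ₁ ℓ₂) where
  open S4Algebra 𝓑
  open BooleanProperties booleanAlgebra

  eval-cong : ∀ {v w} → (∀ n → v n ≈ w n) → ∀ φ → eval 𝓑 v φ ≈ eval 𝓑 w φ
  eval-cong p (var n) = p n
  eval-cong p ⊤̇       = Eq.refl
  eval-cong p ⊥̇       = Eq.refl
  eval-cong p (¬̇ φ)   = ¬-cong (eval-cong p φ)
  eval-cong p (□̇ φ)   = □-cong (eval-cong p φ)
  eval-cong p (φ ∧̇ ψ) = ∧-cong (eval-cong p φ) (eval-cong p ψ)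
  eval-cong p (φ ∨̇ ψ) = ∨-cong (eval-cong p φ) (eval-cong p ψ)

  eval-subst : ∀ {v} s φ → eval 𝓑 v (φ [ s ]) ≡ eval 𝓑 (λ n → eval 𝓑 v (s n)) φ
  eval-subst s (var n) = ≡.refl
  eval-subst s ⊤̇       = ≡.refl
  eval-subst s ⊥̇       = ≡.refl
  eval-subst s (¬̇ φ)   = ≡.cong ¬_ (eval-subst s φ)
  eval-subst s (□̇ φ)   = ≡.cong □_ (eval-subst s φ)
  eval-subst s (φ ∧̇ ψ) = ≡.cong₂ _∧_ (eval-subst s φ) (eval-subst s ψ)
  eval-subst s (φ ∨̇ ψ) = ≡.cong₂ _∨_ (eval-subst s φ) (eval-subst s ψ)

-- □-variants and modal companions

-- GMT before its variables are boxed.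
modal : IFormula → Formula
modal (var n) = var n
modal ⊤ⁱ      = ⊤̇
modal ⊥ⁱ      = ⊥̇
modal (φ ⩀ ψ) = modal φ ∧̇ modal ψ
modal (φ ⩁ ψ) = modal φ ∨̇ modal ψ
modal (φ ⇒ ψ) = □̇ (¬̇ modal φ ∨̇ modal ψ)

-- Brings `GMT` within reach of `^□`: `modal φ` lies in `L ^□` exactly when `GMT φ` lies in `L`.
modal-□ : ∀ φ → modal φ [ (λ q → □̇ var q) ] ≡ GMT φ
modal-□ (var n) = ≡.refl
modal-□ ⊤ⁱ      = ≡.refl
modal-□ ⊥ⁱ      = ≡.refl
modal-□ (φ ⩀ ψ) = ≡.cong₂ _∧̇_ (modal-□ φ) (modal-□ ψ)
modal-□ (φ ⩁ ψ) = ≡.cong₂ _∨̇_ (modal-□ φ) (modal-□ ψ)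
modal-□ (φ ⇒ ψ) = ≡.cong₂ (λ χ θ → □̇ (¬̇ χ ∨̇ θ)) (modal-□ φ) (modal-□ ψ)

syntaxHeyting : RawHeyting _
syntaxHeyting = record
  { Carrier = IFormula ; _∧_ = _⩀_ ; _∨_ = _⩁_ ; _⇨_ = _⇒_ ; ⊤ = ⊤ⁱ ; ⊥ = ⊥ⁱ }

-- An intuitionistic formula whose `GMT` is equivalent over S4 to `□̇` of `φ` with all its variables
-- boxed.
reflectionⁱ : Formula → IFormula
reflectionⁱ φ = reflect (cnf⁺ var φ)
  where open CNF syntaxHeyting

module _ (L : NExtS4 m) where
  open NExtS4 L
  open S4Algebra (lindenbaum L) using (_≈_; ⊤; module Eq; maximum)

  GMT-interpretation : IsOpenInterpretation syntaxHeyting (lindenbaum L) GMT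
  GMT-interpretation = record
    { ∧-hom = λ _ _ → Eq.refl
    ; ∨-hom = λ _ _ → Eq.refl
    ; ⇨-hom = λ _ _ → Eq.refl
    ; ⊤-hom = Eq.refl
    ; ⊥-hom = Eq.refl
    }

  lindenbaum-eval : ∀ s φ → eval (lindenbaum L) s φ ≡ φ [ s ]
  lindenbaum-eval s (var n) = ≡.refl
  lindenbaum-eval s ⊤̇       = ≡.refl
  lindenbaum-eval s ⊥̇       = ≡.refl
  lindenbaum-eval s (¬̇ φ)   = ≡.cong ¬̇_ (lindenbaum-eval s φ)
  lindenbaum-eval s (□̇ φ)   = ≡.cong □̇_ (lindenbaum-eval s φ)
  lindenbaum-eval s (φ ∧̇ ψ) = ≡.cong₂ _∧̇_ (lindenbaum-eval s φ) (lindenbaum-eval s ψ)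
  lindenbaum-eval s (φ ∨̇ ψ) = ≡.cong₂ _∨̇_ (lindenbaum-eval s φ) (lindenbaum-eval s ψ)

  ⊤̇-theorem : theorems ⊤̇
  ⊤̇-theorem = extends (taut λ _ → ≡.refl)

  lindenbaum-valid : ∀ φ → theorems φ ⇔ φ ≈ ⊤
  lindenbaum-valid φ = mk⇔
    (λ p → maximum φ , mp-closed (extends (taut (λ b → weaken (truth b φ)))) p)
    (λ (_ , p) → mp-closed p ⊤̇-theorem)
    where
    weaken : ∀ p → not p ∨ᵇ p ≡ true
    weaken true  = ≡.refl
    weaken false = ≡.refl

  -- `valid⇔reflect` in the Lindenbaum algebra, where being `⊤` means being a theorem. The valuation
  -- `GMT ∘ var` is exactly the substitution of `□̇ var q` for `q`.
  □-variant⇔GMT : ∀ φ → (theorems ^□) φ ⇔ theorems (GMT (reflectionⁱ φ))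
  □-variant⇔GMT φ =
    ≡.subst (λ ψ → theorems ψ ⇔ theorems (GMT (reflectionⁱ φ)))
      (lindenbaum-eval (λ q → □̇ var q) φ)
      (⇔-sym (lindenbaum-valid (GMT (reflectionⁱ φ)))
        ⇔-∘ (valid⇔reflect var φ ⇔-∘ lindenbaum-valid _))
    where open OpenInterpretation GMT-interpretation

module _ (L S : NExtS4 m) where
  private
    module L = NExtS4 L
    module S = NExtS4 S

  -- The formulas `modal φ` serve as tests for the two □-variants.
  ≐-□-variant⇒companion : L.theorems ^□ ≐ S.theorems ^□ → IsModalCompanion S (ρᴸ L)
  ≐-□-variant⇒companion (L⊆S , S⊆L) φ = mk⇔
    (λ p → ≡.subst S.theorems (modal-□ φ)
      (L⊆S {modal φ} (≡.subst L.theorems (≡.sym (modal-□ φ)) p)))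
    (λ p → ≡.subst L.theorems (modal-□ φ)
      (S⊆L {modal φ} (≡.subst S.theorems (≡.sym (modal-□ φ)) p)))

  -- Membership of `φ` in either □-variant is decided by the same intuitionistic formula
  -- `reflectionⁱ φ`.
  companion⇒≐-□-variant : IsModalCompanion S (ρᴸ L) → L.theorems ^□ ≐ S.theorems ^□
  companion⇒≐-□-variant comp = (λ {φ} → to (equiv φ)) , (λ {φ} → from (equiv φ))
    where
    open Equivalence
    equiv : ∀ φ → (L.theorems ^□) φ ⇔ (S.theorems ^□) φ
    equiv φ = ⇔-sym (□-variant⇔GMT S φ) ⇔-∘ (comp (reflectionⁱ φ) ⇔-∘ □-variant⇔GMT L φ)

-- The logics with the □-variant of `L` are precisely the companions of `ρᴸ L`, so both sides ask
-- `L` to contain the same logics.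
□-maximal⇔greatest-companion : (L : NExtS4 m) → □-Maximal L ⇔ IsGreatestModalCompanion L (ρᴸ L)
□-maximal⇔greatest-companion L = mk⇔ greatest maximal
  where
  greatest : □-Maximal L → IsGreatestModalCompanion L (ρᴸ L)
  greatest max = record
    { isModalCompanion = λ _ → ⇔-id _
    ; greatest = λ N comp → max N (companion⇒≐-□-variant L N comp)
    }

  maximal : IsGreatestModalCompanion L (ρᴸ L) → □-Maximal L
  maximal gr S eq = IsGreatestModalCompanion.greatest gr S (≐-□-variant⇒companion L S eq)

-- Validity in ℍ 𝕊 ℙ of the Boolean envelopes

Valid : Formula → S4Algebra c ℓ₁ ℓ₂ → Set (c ⊔ ℓ₁)
Valid φ 𝓑 = ∀ v → eval 𝓑 v φ ≈ ⊤
  where open S4Algebra 𝓑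

module _ {A B : S4Alg ℓ} where
  private
    module A = S4Algebra A
    module B = S4Algebra B

  module _ {f : A.Carrier → B.Carrier} (hom : IsS4Homomorphism A B f) where
    open IsS4Homomorphism hom
    open BooleanProperties B.booleanAlgebra

    eval-hom : ∀ v φ → f (eval A v φ) B.≈ eval B (f ∘ v) φ
    eval-hom v (var n) = B.Eq.refl
    eval-hom v ⊤̇       = ⊤-hom
    eval-hom v ⊥̇       = ⊥-hom
    eval-hom v (¬̇ φ)   = B.Eq.trans (¬-hom _) (¬-cong (eval-hom v φ))
    eval-hom v (□̇ φ)   = B.Eq.trans (□-hom _) (B.□-cong (eval-hom v φ))
    eval-hom v (φ ∧̇ ψ) = B.Eq.trans (∧-hom _ _) (∧-cong (eval-hom v φ) (eval-hom v ψ))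
    eval-hom v (φ ∨̇ ψ) = B.Eq.trans (∨-hom _ _) (∨-cong (eval-hom v φ) (eval-hom v ψ))

  valid-↠ : ∀ φ → A ↠ B → Valid φ A → Valid φ B
  valid-↠ φ (f , hom , surj) valid v =
    B.Eq.trans (eval-cong B (λ n → B.Eq.sym (proj₂ (surj (v n)) A.Eq.refl)) φ)
      (B.Eq.trans (B.Eq.sym (eval-hom hom (λ n → proj₁ (surj (v n))) φ))
        (B.Eq.trans (cong (valid _)) ⊤-hom))
    where open IsS4Homomorphism hom

  valid-↣ : ∀ φ → A ↣ B → Valid φ B → Valid φ A
  valid-↣ φ (f , hom , inj) valid v =
    inj (B.Eq.trans (eval-hom hom v φ) (B.Eq.trans (valid _) (B.Eq.sym ⊤-hom)))
    where open IsS4Homomorphism hom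

module _ {I : Set ℓ} (𝓐 : I → S4Alg ℓ) where
  private
    module 𝓐 i = S4Algebra (𝓐 i)

  eval-∏ : ∀ v φ i → eval (∏ I 𝓐) v φ i ≡ eval (𝓐 i) (λ n → v n i) φ
  eval-∏ v (var n) i = ≡.refl
  eval-∏ v ⊤̇       i = ≡.refl
  eval-∏ v ⊥̇       i = ≡.refl
  eval-∏ v (¬̇ φ)   i = ≡.cong (𝓐.¬_ i) (eval-∏ v φ i)
  eval-∏ v (□̇ φ)   i = ≡.cong (𝓐.□_ i) (eval-∏ v φ i)
  eval-∏ v (φ ∧̇ ψ) i = ≡.cong₂ (𝓐._∧_ i) (eval-∏ v φ i) (eval-∏ v ψ i)
  eval-∏ v (φ ∨̇ ψ) i = ≡.cong₂ (𝓐._∨_ i) (eval-∏ v φ i) (eval-∏ v ψ i)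

  valid-∏ : ∀ φ → (∀ i → Valid φ (𝓐 i)) → Valid φ (∏ I 𝓐)
  valid-∏ φ valid v i =
    𝓐.Eq.trans i (𝓐.Eq.reflexive i (eval-∏ v φ i)) (valid i _)

-- Validity passes to products, subalgebras and homomorphic images, so it need only be checked on
-- the envelopes.
valid-σ : ∀ {𝐏 : Pred (HeytingAlg ℓ) k} φ →
  (∀ {H A} → 𝐏 H → IsBooleanEnvelope H A → Valid φ A) → ∀ {A} → σ 𝐏 A → Valid φ A
valid-σ φ valid (B , (C , (I , 𝓐 , env , f , hom , inj , _) , C↣) , B↠A) =
  valid-↠ φ B↠A (valid-↣ φ C↣ (valid-↣ φ (f , hom , inj) (valid-∏ 𝓐 φ
    λ i → let _ , H∈𝐏 , H-env = env i in valid H∈𝐏 H-env)))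

-- Elements of a Boolean envelope as values of formulas

-- Cantor's enumeration of ℕ × ℕ along the antidiagonals.
nextPair : ℕ × ℕ → ℕ × ℕ
nextPair (i , ℕ.zero)  = ℕ.zero , ℕ.suc i
nextPair (i , ℕ.suc j) = ℕ.suc i , j

unpair : ℕ → ℕ × ℕ
unpair ℕ.zero    = ℕ.zero , ℕ.zero
unpair (ℕ.suc k) = nextPair (unpair k)

unpair-surjective : ∀ i j → ∃ λ k → unpair k ≡ (i , j)
unpair-surjective i j = go (i + j) i j ≡.refl
  where
  go : ∀ d i j → i + j ≡ d → ∃ λ k → unpair k ≡ (i , j)
  go d ℕ.zero ℕ.zero p = ℕ.zero , ≡.refl
  -- `(0 , suc j)` opens its antidiagonal and follows `(j , 0)`, the end of the previous one, so `d`
  -- drops; in the last clause `i` drops.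
  go (ℕ.suc d) ℕ.zero (ℕ.suc j) ≡.refl with k , eq ← go d j ℕ.zero (+-identityʳ j) =
    ℕ.suc k , ≡.cong nextPair eq
  go d (ℕ.suc i) j p with k , eq ← go d i (ℕ.suc j) (≡.trans (+-suc i j) p) =
    ℕ.suc k , ≡.cong nextPair eq

module _ {X : Set a} (𝓑 : S4Algebra c ℓ₁ ℓ₂) (η : X → S4Algebra.Carrier 𝓑) where
  open S4Algebra 𝓑
  open BooleanProperties booleanAlgebra

  Definable : Carrier → Set (a ⊔ ℓ₁)
  Definable x = ∃ λ (u : ℕ → X) → ∃ λ ψ → eval 𝓑 (η ∘ u) ψ ≈ x

  -- One parameter sequence `u` serves all `n`, so that the defining formulas form a substitution,
  -- as `Schem` requires.
  JointlyDefinable : (ℕ → Carrier) → Set (a ⊔ ℓ₁)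
  JointlyDefinable v =
    ∃ λ (u : ℕ → X) → ∃ λ (s : ℕ → Formula) → ∀ n → eval 𝓑 (η ∘ u) (s n) ≈ v n

  -- The variables of the separate definitions are renamed apart: variable `i` of the `n`-th becomes
  -- a code of `(n , i)`.
  jointly-definable : ∀ {v} → (∀ n → Definable (v n)) → JointlyDefinable v
  jointly-definable {v} def = u , s , λ n →
    Eq.trans (Eq.reflexive (eval-subst 𝓑 (rename n) (ψ n)))
      (Eq.trans (eval-cong 𝓑 (λ i → Eq.reflexive (≡.cong η (u-pair n i))) (ψ n))
        (proj₂ (proj₂ (def n))))
    where
    u : ℕ → X
    u k = let n , i = unpair k in proj₁ (def n) i

    ψ : ℕ → Formula
    ψ n = proj₁ (proj₂ (def n))

    rename : ℕ → ℕ → Formula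
    rename n i = var (proj₁ (unpair-surjective n i))

    s : ℕ → Formula
    s n = ψ n [ rename n ]

    u-pair : ∀ n i → u (proj₁ (unpair-surjective n i)) ≡ proj₁ (def n) i
    u-pair n i = ≡.cong (λ (n , i) → proj₁ (def n) i) (proj₂ (unpair-surjective n i))

  definable₂ : ∀ {x y} → Definable x → Definable y →
    ∃ λ (u : ℕ → X) → ∃ λ ψ → ∃ λ χ → eval 𝓑 (η ∘ u) ψ ≈ x × eval 𝓑 (η ∘ u) χ ≈ y
  definable₂ {x} {y} dx dy =
    -- The sequence `x , y , y , …` reduces the binary case to the countable one.
    let u , s , eq = jointly-definable {v = v} (λ { ℕ.zero → dx ; (ℕ.suc _) → dy })
    in u , s 0 , s 1 , eq 0 , eq 1
    where
    v : ℕ → Carrier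
    v ℕ.zero    = x
    v (ℕ.suc _) = y

  -- `x₀` is a default parameter for the constants, whose derivations supply none.
  generated⇒definable : X → ∀ {x} → Generated booleanAlgebra η x → Definable x
  generated⇒definable x₀ (gen a)      = (λ _ → a) , var 0 , Eq.refl
  generated⇒definable x₀ (∧-gen p q)
    with u , ψ , χ , eq , eq′ ← definable₂ (generated⇒definable x₀ p) (generated⇒definable x₀ q)
    = u , ψ ∧̇ χ , ∧-cong eq eq′
  generated⇒definable x₀ (∨-gen p q)
    with u , ψ , χ , eq , eq′ ← definable₂ (generated⇒definable x₀ p) (generated⇒definable x₀ q)
    = u , ψ ∨̇ χ , ∨-cong eq eq′
  generated⇒definable x₀ (¬-gen p)
    with u , ψ , eq ← generated⇒definable x₀ p = u , ¬̇ ψ , ¬-cong eq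
  generated⇒definable x₀ ⊤-gen        = (λ _ → x₀) , ⊤̇ , Eq.refl
  generated⇒definable x₀ ⊥-gen        = (λ _ → x₀) , ⊥̇ , Eq.refl
  generated⇒definable x₀ (≈-gen e p)
    with u , ψ , eq ← generated⇒definable x₀ p = u , ψ , Eq.trans eq e

-- A Heyting algebra inside its Boolean envelope

module Envelope {H : HeytingAlg ℓ} {A : S4Alg ℓ} (env : IsBooleanEnvelope H A) where
  private
    module H = HeytingAlgebra H
  open S4Algebra A
  open BooleanProperties booleanAlgebra
  open IsBooleanEnvelope env
  open PrimeFilter

  -- Elements of the envelope are determined by the prime filters they represent, so each law for
  -- `η` becomes a condition on prime filters.
  η-ext : ∀ {a x} → (λ F → member F a) ≐ ⟦ x ⟧ → η a ≈ x
  η-ext {a} (⊆x , x⊆) =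
    ⟦⟧-inj ((λ p → ⊆x (proj₁ (⟦η⟧ a) p)) , (λ p → proj₂ (⟦η⟧ a) (x⊆ p)))

  η-cong : ∀ {a b} → a H.≈ b → η a ≈ η b
  η-cong {a} {b} a≈b = η-ext
    ( (λ {F} p → proj₂ (⟦η⟧ b) (upward F (H.reflexive a≈b) p))
    , (λ {F} p → upward F (H.reflexive (H.Eq.sym a≈b)) (proj₁ (⟦η⟧ b) p)))

  η-∧ : ∀ a b → η (a H.∧ b) ≈ η a ∧ η b
  η-∧ a b = η-ext
    ( (λ {F} p → proj₂ (⟦∧⟧ _ _) ( proj₂ (⟦η⟧ a) (upward F (H.x∧y≤x a b) p)
                                 , proj₂ (⟦η⟧ b) (upward F (H.x∧y≤y a b) p)))
    , (λ {F} p → let p₁ , p₂ = proj₁ (⟦∧⟧ _ _) p in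
        ∧-in F (proj₁ (⟦η⟧ a) p₁) (proj₁ (⟦η⟧ b) p₂)))

  η-∨ : ∀ a b → η (a H.∨ b) ≈ η a ∨ η b
  η-∨ a b = η-ext
    ( (λ {F} p → proj₂ (⟦∨⟧ _ _) (Sum.map (proj₂ (⟦η⟧ a)) (proj₂ (⟦η⟧ b)) (prime F p)))
    , (λ {F} p → [ (λ q → upward F (H.x≤x∨y a b) (proj₁ (⟦η⟧ a) q))
                 , (λ q → upward F (H.y≤x∨y a b) (proj₁ (⟦η⟧ b) q))
                 ]′ (proj₁ (⟦∨⟧ _ _) p)))

  η-⊤ : η H.⊤ ≈ ⊤
  η-⊤ = η-ext ((λ _ → proj₂ ⟦⊤⟧ _) , (λ {F} _ → ⊤-in F))

  η-⊥ : η H.⊥ ≈ ⊥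
  η-⊥ = η-ext ((λ {F} p → ⊥-elim (⊥-out F p)) , (λ p → ⊥-elim (proj₁ ⟦⊥⟧ p)))

  η-⇨ : ∀ c d → η (c H.⇨ d) ≈ □ (¬ η c ∨ η d)
  η-⇨ c d = begin
    -- The padding by `⊤` matches the base of `foldr` in the one-clause instance of `□-envelope`.
    η (c H.⇨ d)               ≈⟨ ∧-identityʳ _ ⟨
    η (c H.⇨ d) ∧ ⊤           ≈⟨ ∧-cong Eq.refl η-⊤ ⟨
    η (c H.⇨ d) ∧ η H.⊤       ≈⟨ η-∧ _ _ ⟨
    η ((c H.⇨ d) H.∧ H.⊤)     ≈⟨ □-envelope ((c , d) ∷ []) ⟨
    □ ((¬ η c ∨ η d) ∧ ⊤)     ≈⟨ □-cong (∧-identityʳ _) ⟩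
    □ (¬ η c ∨ η d)           ∎
    where open ≈-Reasoning setoid

  interpretation : IsOpenInterpretation (rawHeyting H) A η
  interpretation = record
    { ∧-hom = η-∧ ; ∨-hom = η-∨ ; ⇨-hom = η-⇨ ; ⊤-hom = η-⊤ ; ⊥-hom = η-⊥ }

homomorphism⇒interpretation : ∀ {H : HeytingAlg ℓ} {𝓑 : S4Alg ℓ} {f} →
  IsHeytingHomomorphism H (openAlgebra 𝓑) f →
  IsOpenInterpretation (rawHeyting H) 𝓑 (proj₁ ∘ f)
homomorphism⇒interpretation hom = record
  { ∧-hom = ∧-hom ; ∨-hom = ∨-hom ; ⇨-hom = ⇨-hom ; ⊤-hom = ⊤-hom ; ⊥-hom = ⊥-hom }
  where open IsHeytingHomomorphism hom

-- The valuation `v` is the substitution `s` evaluated at elements `η (u n)`. Validity of `φ [ s ]`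
-- there depends on one element of `H`, which `f` carries to `𝓑`, where the hypothesis applies to
-- `s`.
envelope-valid : ∀ {𝐊 : Pred (S4Alg ℓ) k} {H A} φ →
  Schem (Log 𝐊 ^□) φ → ρ 𝐊 H → IsBooleanEnvelope H A → Valid φ A
envelope-valid {H = H} {A} φ valid (𝓑 , 𝓑∈𝐊 , f , hom , inj , _) env v = begin
  eval A v φ                                ≈⟨ eval-cong A s≈v φ ⟨
  eval A (λ n → eval A (η ∘ u) (s n)) φ     ≡⟨ eval-subst A s φ ⟨
  eval A (η ∘ u) (φ [ s ])                  ≈⟨ from (AH.valid⇔reflect u (φ [ s ])) reflected ⟩
  ⊤                                         ∎
  where
  open IsBooleanEnvelope env
  open S4Algebra A
  open ≈-Reasoning setoid
  open Equivalence
  open CNF (rawHeyting H)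
  module 𝓑 = S4Algebra 𝓑
  module H = HeytingAlgebra H
  module AH = OpenInterpretation (Envelope.interpretation env)
  module BH = OpenInterpretation (homomorphism⇒interpretation {H = H} {𝓑} hom)

  definable : JointlyDefinable A η v
  definable = jointly-definable A η (λ n → generated⇒definable A η H.⊤ (generated (v n)))

  u = proj₁ definable
  s = proj₁ (proj₂ definable)
  s≈v = proj₂ (proj₂ definable)

  w : ℕ → 𝓑.Carrier
  w = proj₁ ∘ f ∘ u

  valid-in-𝓑 : eval 𝓑 w (φ [ s ]) 𝓑.≈ 𝓑.⊤
  -- The values `w n` are open, so `w` agrees with its boxed version, which is what `^□` evaluates.
  valid-in-𝓑 = 𝓑.Eq.trans (eval-cong 𝓑 (λ n → proj₂ (f (u n))) (φ [ s ]))
    (𝓑.Eq.trans (𝓑.Eq.reflexive (≡.sym (eval-subst 𝓑 (λ q → □̇ var q) (φ [ s ]))))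
      (valid s 𝓑 𝓑∈𝐊 w))

  reflected : η (reflect (cnf⁺ u (φ [ s ]))) ≈ ⊤
  -- Both algebras reflect `φ [ s ]` to the same element of `H`; injectivity of `f` shows that it is
  -- `⊤` already in `H`.
  reflected = Eq.trans
    (Envelope.η-cong env {b = H.⊤}
      (inj (𝓑.Eq.trans (to (BH.valid⇔reflect u (φ [ s ])) valid-in-𝓑)
             (𝓑.Eq.sym (IsHeytingHomomorphism.⊤-hom hom)))))
    (Envelope.η-⊤ env)

-- Ultrafilters

-- The element `p` is built in so that a maximal such filter is an ultrafilter through `p`.
record ProperFilter (B : BooleanAlgebra ℓ ℓ ℓ) (p : BooleanAlgebra.Carrier B) : Set (suc ℓ) where
  open BooleanAlgebra B
  field
    member : Pred Carrier ℓ
    upward : ∀ {a b} → a ≤ b → member a → member b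
    ∧-in   : ∀ {a b} → member a → member b → member (a ∧ b)
    base   : member p
    ⊥-out  : member ⊥ → Empty

module Classical (em : ExcludedMiddle (suc ℓ)) where

  decide : (P : Set ℓ) → Dec P
  decide P = map′ lower lift (em {Lift (suc ℓ) P})

  -- Excluded middle lets the union of a chain of filters, a predicate of
  -- level suc ℓ, be a filter of level ℓ again.
  Resize : Set (suc ℓ) → Set ℓ
  Resize P = Lift ℓ (True (em {P}))

  resize : ∀ {P} → P → Resize P
  resize p = lift (fromWitness p)

  unresize : ∀ {P} → Resize P → P
  unresize (lift p) = toWitness p

  module _ (zorn : ZornsLemma (suc ℓ)) (B : BooleanAlgebra ℓ ℓ ℓ) where
    open BooleanAlgebra B
    open BooleanProperties B
    open ProperFilter

    module _ (p : Carrier) (p≰⊥ : p ≤ ⊥ → Empty) where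

      filterPoset : Poset (suc ℓ) (suc ℓ) (suc ℓ)
      filterPoset = record
        { Carrier = ProperFilter B p
        ; _≈_ = λ F G → Lift (suc ℓ) (member F ≐ member G)
        ; _≤_ = λ F G → Lift (suc ℓ) (member F ⊆ member G)
        ; isPartialOrder = record
          { isPreorder = record
            { isEquivalence = record
              { refl = lift (id , id)
              ; sym = λ (lift (f , g)) → lift (g , f)
              ; trans = λ (lift (f , g)) (lift (f′ , g′)) →
                  lift ((λ x → f′ (f x)) , (λ x → g (g′ x)))
              }
            ; reflexive = λ (lift (f , _)) → lift f
            ; trans = λ (lift f) (lift g) → lift (λ x → g (f x))
            }
          ; antisym = λ (lift f) (lift g) → lift (f , g)
          }
        }

      private
        module FP = Poset filterPoset

      chain-bound : (C : Pred (ProperFilter B p) (suc ℓ)) →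
        (∀ {F G} → C F → C G → F FP.≤ G ⊎ G FP.≤ F) →
        ∃ λ U → ∀ {F} → C F → F FP.≤ U
      chain-bound C chain = U , λ C-F → lift λ x → resize (inj₂ (_ , C-F , x))
        where
        InUnion : Carrier → Set (suc ℓ)
        -- The first disjunct is the principal filter of `p`, which bounds the empty chain.
        InUnion a = p ≤ a ⊎ ∃ λ F → C F × member F a

        in-∧ : ∀ {a b} → InUnion a → InUnion b → InUnion (a ∧ b)
        in-∧ (inj₁ p≤a) (inj₁ p≤b) = inj₁ (∧-greatest p≤a p≤b)
        in-∧ (inj₁ p≤a) (inj₂ (F , C-F , x)) =
          inj₂ (F , C-F , ∧-in F (upward F p≤a (base F)) x)
        in-∧ (inj₂ (F , C-F , x)) (inj₁ p≤b) =
          inj₂ (F , C-F , ∧-in F x (upward F p≤b (base F)))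
        in-∧ (inj₂ (F , C-F , x)) (inj₂ (G , C-G , y)) with chain C-F C-G
        ... | inj₁ (lift F⊆G) = inj₂ (G , C-G , ∧-in G (F⊆G x) y)
        ... | inj₂ (lift G⊆F) = inj₂ (F , C-F , ∧-in F x (G⊆F y))

        U : ProperFilter B p
        U = record
          { member = λ a → Resize (InUnion a)
          ; upward = λ a≤b x → resize
              (Sum.map (λ p≤a → trans p≤a a≤b)
                       (λ (F , C-F , y) → F , C-F , upward F a≤b y) (unresize x))
          ; ∧-in = λ x y → resize (in-∧ (unresize x) (unresize y))
          ; base = resize (inj₁ refl)
          ; ⊥-out = λ x → [ p≰⊥ , (λ (F , _ , y) → ⊥-out F y) ]′ (unresize x)
          }

      -- The filter generated by `F` and `a`.
      adjoin : (F : ProperFilter B p) (a : Carrier) →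
        ((∃ λ w → member F w × w ∧ a ≤ ⊥) → Empty) → ProperFilter B p
      adjoin F a proper = record
        { member = λ b → ∃ λ w → member F w × w ∧ a ≤ b
        ; upward = λ b≤c (w , x , le) → w , x , trans le b≤c
        ; ∧-in = λ (w , x , le) (w′ , x′ , le′) → w ∧ w′ , ∧-in F x x′ ,
            ∧-greatest
              (trans (∧-greatest (trans (x∧y≤x _ _) (x∧y≤x _ _)) (x∧y≤y _ _)) le)
              (trans (∧-greatest (trans (x∧y≤x _ _) (x∧y≤y _ _)) (x∧y≤y _ _)) le′)
        ; base = p , base F , x∧y≤x _ _
        ; ⊥-out = proper
        }

      -- If some `w` in the maximal filter is disjoint from `a`, then `w ≤ ¬ a`; otherwise adjoining
      -- `a` keeps the filter proper, and maximality puts `a` in it.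
      ultrafilter : ∃ λ (W : ProperFilter B p) → ∀ a → member W a ⊎ member W (¬ a)
      ultrafilter = W , ultra
        where
        W = proj₁ (zorn filterPoset chain-bound)
        W-max = proj₂ (zorn filterPoset chain-bound)

        ultra : ∀ a → member W a ⊎ member W (¬ a)
        ultra a with decide (∃ λ w → member W w × w ∧ a ≤ ⊥)
        ... | yes (w , x , le) = inj₂ (upward W (x∧y≤⊥⇒x≤¬y le) x)
        ... | no proper = inj₁ (proj₁ (lower (W-max {adjoin W a proper}
                (lift λ {w} x → w , x , x∧y≤x _ _))) (p , base W , x∧y≤y _ _))

-- The subalgebra generated by the open elements is their Boolean envelope

module _ (𝓑 : S4Alg ℓ) where
  open S4Algebra 𝓑

  OpenGenerated : Pred Carrier ℓ
  OpenGenerated = Generated {X = HeytingAlgebra.Carrier (openAlgebra 𝓑)} booleanAlgebra proj₁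

  -- Closure under `□` is immediate: `□ x` is open, hence itself a generator.
  openGenerated : S4Alg ℓ
  openGenerated = record
    { booleanAlgebra = record
      { Carrier = ∃ OpenGenerated
      ; _≈_ = λ x y → proj₁ x ≈ proj₁ y
      ; _≤_ = λ x y → proj₁ x ≤ proj₁ y
      ; _∨_ = λ (x , p) (y , q) → x ∨ y , ∨-gen p q
      ; _∧_ = λ (x , p) (y , q) → x ∧ y , ∧-gen p q
      ; ¬_ = λ (x , p) → ¬ x , ¬-gen p
      ; ⊤ = ⊤ , ⊤-gen
      ; ⊥ = ⊥ , ⊥-gen
      ; isBooleanAlgebra = record { isHeytingAlgebra = record
        { isBoundedLattice = record
          { isLattice = record
            { isPartialOrder = record
              { isPreorder = record
                { isEquivalence = record { refl = Eq.refl ; sym = Eq.sym ; trans = Eq.trans }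
                ; reflexive = reflexive
                ; trans = trans
                }
              ; antisym = antisym
              }
            ; supremum = λ (x , _) (y , _) →
                x≤x∨y x y , y≤x∨y x y , λ _ → ∨-least
            ; infimum = λ (x , _) (y , _) →
                x∧y≤x x y , x∧y≤y x y , λ _ → ∧-greatest
            }
          ; maximum = λ (x , _) → maximum x
          ; minimum = λ (x , _) → minimum x
          }
        ; exponential = λ (x , _) (y , _) (z , _) → exponential x y z
        } }
      }
    ; □_ = λ (x , _) → □ x , gen (□ x , □-idem 𝓑 x)
    ; □-cong = □-cong
    ; □-⊤ = □-⊤
    ; □-∧ = λ (x , _) (y , _) → □-∧ x y
    ; □-T = λ (x , _) → □-T x
    ; □-4 = λ (x , _) → □-4 x
    }

  inclusion-hom : IsS4Homomorphism openGenerated 𝓑 proj₁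
  inclusion-hom = record
    { cong = id
    ; ∧-hom = λ _ _ → Eq.refl
    ; ∨-hom = λ _ _ → Eq.refl
    ; ¬-hom = λ _ → Eq.refl
    ; ⊤-hom = Eq.refl
    ; ⊥-hom = Eq.refl
    ; □-hom = λ _ → Eq.refl
    }

module OpenGeneratedEnvelope (em : ExcludedMiddle (suc ℓ)) (zorn : ZornsLemma (suc ℓ))
    (𝓑 : S4Alg ℓ) where
  private
    H : HeytingAlg ℓ
    H = openAlgebra 𝓑
    module H = HeytingAlgebra H
    A = openGenerated 𝓑
    module A = S4Algebra A
  open Classical em
  open S4Algebra 𝓑
  open BooleanProperties booleanAlgebra
  open PrimeFilter

  -- The filter generated by a prime filter F of open elements together with
  -- the complements of the open elements outside F: an ultrafilter of A.
  Extension : PrimeFilter H → Pred Carrier ℓ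
  Extension F x = ∃ λ c → ∃ λ d →
    member F c × (member F d → Empty) × proj₁ c ∧ ¬ proj₁ d ≤ x

  ext-upward : ∀ F {x y} → x ≤ y → Extension F x → Extension F y
  ext-upward F x≤y (c , d , c∈ , d∉ , le) = c , d , c∈ , d∉ , trans le x≤y

  -- `(c ∧ ¬ d) ∧ (c′ ∧ ¬ d′)` is `(c ∧ c′) ∧ ¬ (d ∨ d′)`, and primeness keeps `d ∨ d′` outside `F`.
  ext-∧ : ∀ F {x y} → Extension F x → Extension F y → Extension F (x ∧ y)
  ext-∧ F (c , d , c∈ , d∉ , le) (c′ , d′ , c′∈ , d′∉ , le′) =
    c H.∧ c′ , d H.∨ d′ , ∧-in F c∈ c′∈ , (λ p → [ d∉ , d′∉ ]′ (prime F p)) ,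
    ∧-greatest
      (trans (∧-greatest (trans (x∧y≤x _ _) (x∧y≤x _ _))
                         (trans (x∧y≤y _ _) (¬-anti (x≤x∨y _ _)))) le)
      (trans (∧-greatest (trans (x∧y≤x _ _) (x∧y≤y _ _))
                         (trans (x∧y≤y _ _) (¬-anti (y≤x∨y _ _)))) le′)

  ext-∈ : ∀ F a → member F a → Extension F (proj₁ a)
  ext-∈ F a a∈ = a , H.⊥ , a∈ , ⊥-out F , x∧y≤x _ _

  ext-∉ : ∀ F a → (member F a → Empty) → Extension F (¬ proj₁ a)
  ext-∉ F a a∉ = H.⊤ , a , ⊤-in F , a∉ , x∧y≤y _ _

  -- `c ∧ ¬ d ≤ a` gives `c ≤ d ∨ a`, so primeness of `F` and `d ∉ F` leave only `a`.
  ext-open : ∀ F a → Extension F (proj₁ a) → member F a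
  ext-open F a (c , d , c∈ , d∉ , le) with prime F {d} {a} (upward F (x∧¬y≤z⇒x≤y∨z le) c∈)
  ... | inj₁ d∈ = ⊥-elim (d∉ d∈)
  ... | inj₂ a∈ = a∈

  ext-proper : ∀ F {x} → Extension F x → Extension F (¬ x) → Empty
  ext-proper F p q = ⊥-out F (ext-open F H.⊥ (ext-upward F x∧¬x≤⊥ (ext-∧ F p q)))

  -- Induction on generation: excluded middle decides the open generators, and the Boolean
  -- operations preserve being decided.
  ext-ultra : ∀ F {x} → OpenGenerated 𝓑 x → Extension F x ⊎ Extension F (¬ x)
  ext-ultra F (gen a) with decide (member F a)
  ... | yes a∈ = inj₁ (ext-∈ F a a∈)
  ... | no  a∉ = inj₂ (ext-∉ F a a∉)
  ext-ultra F (∧-gen p q) with ext-ultra F p | ext-ultra F q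
  ... | inj₁ x∈  | inj₁ y∈  = inj₁ (ext-∧ F x∈ y∈)
  ... | inj₂ ¬x∈ | _        = inj₂ (ext-upward F (¬-anti (x∧y≤x _ _)) ¬x∈)
  ... | inj₁ _   | inj₂ ¬y∈ = inj₂ (ext-upward F (¬-anti (x∧y≤y _ _)) ¬y∈)
  ext-ultra F (∨-gen p q) with ext-ultra F p | ext-ultra F q
  ... | inj₁ x∈  | _        = inj₁ (ext-upward F (x≤x∨y _ _) x∈)
  ... | inj₂ _   | inj₁ y∈  = inj₁ (ext-upward F (y≤x∨y _ _) y∈)
  ... | inj₂ ¬x∈ | inj₂ ¬y∈ =
    inj₂ (ext-upward F (reflexive (Eq.sym (deMorgan₂ _ _))) (ext-∧ F ¬x∈ ¬y∈))
  ext-ultra F (¬-gen p) with ext-ultra F p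
  ... | inj₁ x∈  = inj₂ (ext-upward F (reflexive (Eq.sym (¬-involutive _))) x∈)
  ... | inj₂ ¬x∈ = inj₁ ¬x∈
  ext-ultra F ⊤-gen = inj₁ (ext-∈ F H.⊤ (⊤-in F))
  ext-ultra F ⊥-gen = inj₂ (ext-∉ F H.⊥ (⊥-out F))
  ext-ultra F (≈-gen x≈y p) with ext-ultra F p
  ... | inj₁ x∈  = inj₁ (ext-upward F (reflexive x≈y) x∈)
  ... | inj₂ ¬x∈ = inj₂ (ext-upward F (¬-anti (reflexive (Eq.sym x≈y))) ¬x∈)

  -- An ultrafilter of 𝓑 containing x ∧ ¬ y restricts to a prime filter of H
  -- whose extension contains x but not y.
  ext-reflects-≤ : ∀ {x y} → OpenGenerated 𝓑 x →
    (∀ F → Extension F x → Extension F y) → x ≤ y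
  ext-reflects-≤ {x} {y} x-gen x⊆y = decidable-stable (decide (x ≤ y)) λ x≰y →
    let W , ultra = ultrafilter zorn booleanAlgebra (x ∧ ¬ y) (λ le → x≰y (x∧¬y≤⊥⇒x≤y le))
    in separated W ultra
    where
    module _ (W : ProperFilter booleanAlgebra (x ∧ ¬ y))
        (ultra : ∀ a → ProperFilter.member W a ⊎ ProperFilter.member W (¬ a)) where
      private
        module W = ProperFilter W

      W-proper : ∀ {a} → W.member a → W.member (¬ a) → Empty
      W-proper p q = W.⊥-out (W.upward x∧¬x≤⊥ (W.∧-in p q))

      F : PrimeFilter H
      F = record
        { member = λ a → W.member (proj₁ a)
        ; upward = W.upward
        ; ⊤-in = W.upward (maximum _) W.base
        ; ∧-in = W.∧-in
        ; ⊥-out = W.⊥-out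
        ; prime = λ {a} {b} a∨b∈ → Sum.map₂
            -- `(a ∨ b) ∧ ¬ a ≤ b`.
            (λ ¬a∈ → W.upward (x≤y∨z⇒x∧¬y≤z refl) (W.∧-in a∨b∈ ¬a∈)) (ultra (proj₁ a))
        }

      ext⊆W : ∀ {z} → Extension F z → W.member z
      ext⊆W (c , d , c∈ , d∉ , le) =
        W.upward le (W.∧-in c∈ ([ (λ d∈ → ⊥-elim (d∉ d∈)) , id ]′ (ultra (proj₁ d))))

      x∈ext : Extension F x
      -- The extension decides `x`, and it lies within `W`, which already contains `x`; so it cannot
      -- choose `¬ x`.
      x∈ext with ext-ultra F x-gen
      ... | inj₁ x∈  = x∈
      ... | inj₂ ¬x∈ = ⊥-elim (W-proper (W.upward (x∧y≤x _ _) W.base) (ext⊆W ¬x∈))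

      separated : Empty
      separated = W-proper (ext⊆W (x⊆y F x∈ext)) (W.upward (x∧y≤y _ _) W.base)

  open-interpretation : IsOpenInterpretation (rawHeyting H) A (λ a → proj₁ a , gen a)
  open-interpretation = record
    { ∧-hom = λ _ _ → Eq.refl
    ; ∨-hom = λ _ _ → Eq.refl
    ; ⇨-hom = λ _ _ → Eq.refl
    ; ⊤-hom = Eq.refl
    ; ⊥-hom = Eq.refl
    }

  generated-in-A : ∀ {x} (x-gen : OpenGenerated 𝓑 x) →
    Generated A.booleanAlgebra (λ a → proj₁ a , gen a) (x , x-gen)
  generated-in-A (gen a)       = gen a
  generated-in-A (∧-gen p q)   = ∧-gen (generated-in-A p) (generated-in-A q)
  generated-in-A (∨-gen p q)   = ∨-gen (generated-in-A p) (generated-in-A q)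
  generated-in-A (¬-gen p)     = ¬-gen (generated-in-A p)
  generated-in-A ⊤-gen         = ⊤-gen
  generated-in-A ⊥-gen         = ⊥-gen
  generated-in-A (≈-gen x≈y p) = ≈-gen x≈y (generated-in-A p)

  -- An element is represented by the prime filters whose extensions contain it. The extensions
  -- being ultrafilters gives the Boolean clauses, and `ext-reflects-≤` gives injectivity.
  isBooleanEnvelope : IsBooleanEnvelope H A
  isBooleanEnvelope = record
    { ⟦_⟧ = λ (x , _) F → Extension F x
    ; ⟦⟧-cong = λ x≈y → (λ {F} → ext-upward F (reflexive x≈y)) ,
                        (λ {F} → ext-upward F (reflexive (Eq.sym x≈y)))
    ; ⟦⟧-inj = λ {(_ , x-gen)} {(_ , y-gen)} (x⊆y , y⊆x) →
        antisym (ext-reflects-≤ x-gen (λ F → x⊆y {F})) (ext-reflects-≤ y-gen (λ F → y⊆x {F}))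
    ; ⟦∧⟧ = λ _ _ →
        (λ {F} p → ext-upward F (x∧y≤x _ _) p , ext-upward F (x∧y≤y _ _) p) ,
        (λ {F} (p , q) → ext-∧ F p q)
    ; ⟦∨⟧ = λ (_ , x-gen) _ →
        (λ {F} p → Sum.map₂
          (λ ¬x∈ → ext-upward F (x≤y∨z⇒x∧¬y≤z refl) (ext-∧ F p ¬x∈)) (ext-ultra F x-gen)) ,
        (λ {F} → [ ext-upward F (x≤x∨y _ _) , ext-upward F (y≤x∨y _ _) ]′)
    ; ⟦¬⟧ = λ (_ , x-gen) →
        (λ {F} ¬x∈ x∈ → ext-proper F x∈ ¬x∈) ,
        (λ {F} x∉ → [ (λ x∈ → ⊥-elim (x∉ x∈)) , id ]′ (ext-ultra F x-gen))
    ; ⟦⊤⟧ = _ , (λ {F} _ → ext-∈ F H.⊤ (⊤-in F))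
    ; ⟦⊥⟧ = (λ {F} p → ⊥-out F (ext-open F H.⊥ p)) , λ ()
    ; η = λ a → proj₁ a , gen a
    ; ⟦η⟧ = λ a → (λ {F} → ext-open F a) , (λ {F} → ext-∈ F a)
    ; generated = λ (_ , x-gen) → generated-in-A x-gen
    -- The prescribed action of `□` is `□-value` for the inclusion of the open elements.
    ; □-envelope = OpenInterpretation.□-value open-interpretation
    }

-- Identities, one-factor products and the two inclusions

id-≅ᴴ : (H : HeytingAlg ℓ) → H ≅ᴴ H
id-≅ᴴ H = id , hom , id , λ y → y , id
  where
  open HeytingAlgebra H
  hom : IsHeytingHomomorphism H H id
  hom = record
    { cong = id
    ; ∧-hom = λ _ _ → Eq.refl
    ; ∨-hom = λ _ _ → Eq.refl
    ; ⇨-hom = λ _ _ → Eq.refl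
    ; ⊤-hom = Eq.refl
    ; ⊥-hom = Eq.refl
    }

id-hom : (A : S4Alg ℓ) → IsS4Homomorphism A A id
id-hom A = record
  { cong = id
  ; ∧-hom = λ _ _ → Eq.refl
  ; ∨-hom = λ _ _ → Eq.refl
  ; ¬-hom = λ _ → Eq.refl
  ; ⊤-hom = Eq.refl
  ; ⊥-hom = Eq.refl
  ; □-hom = λ _ → Eq.refl
  }
  where open S4Algebra A

≅-∏-⊤ : (A : S4Alg ℓ) → A ≅ ∏ (Lift ℓ Unit) (λ _ → A)
≅-∏-⊤ A = (λ x _ → x) , hom , (λ p → p _) , λ y → y _ , λ z≈y _ → z≈y
  where
  open S4Algebra A
  hom : IsS4Homomorphism A (∏ _ (λ _ → A)) (λ x _ → x)
  hom = record
    { cong = λ p _ → p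
    ; ∧-hom = λ _ _ _ → Eq.refl
    ; ∨-hom = λ _ _ _ → Eq.refl
    ; ¬-hom = λ _ _ → Eq.refl
    ; ⊤-hom = λ _ → Eq.refl
    ; ⊥-hom = λ _ → Eq.refl
    ; □-hom = λ _ _ → Eq.refl
    }

envelope∈σ : ∀ {𝐏 : Pred (HeytingAlg ℓ) k} {H A} → 𝐏 H → IsBooleanEnvelope H A → σ 𝐏 A
envelope∈σ {H = H} {A} H∈𝐏 env =
  A , (A , (_ , _ , (λ _ → H , H∈𝐏 , env) , ≅-∏-⊤ A) , id , id-hom A , id) ,
  id , id-hom A , λ y → y , id

-- The subalgebra of `𝓑` generated by its open elements is an envelope of an algebra in `ρ 𝐊`, and
-- it contains the values of all `s n` under a boxed valuation. This is the inclusion that rests on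
-- Zorn's lemma.
Log-σρ⊆Schem : ExcludedMiddle (suc ℓ) → ZornsLemma (suc ℓ) → (𝐊 : Pred (S4Alg ℓ) k) →
  ∀ φ → Log (σ (ρ 𝐊)) φ → Schem (Log 𝐊 ^□) φ
Log-σρ⊆Schem em zorn 𝐊 φ valid s 𝓑 𝓑∈𝐊 v = begin
  eval 𝓑 v (φ [ s ] [ (λ q → □̇ var q) ])  ≡⟨ eval-subst 𝓑 _ (φ [ s ]) ⟩
  eval 𝓑 (λ n → □ v n) (φ [ s ])          ≈⟨ eval-hom (inclusion-hom 𝓑) w (φ [ s ]) ⟨
  proj₁ (eval A w (φ [ s ]))              ≡⟨ ≡.cong proj₁ (eval-subst A s φ) ⟩
  proj₁ (eval A _ φ)                      ≈⟨ valid A A∈σρ𝐊 _ ⟩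
  ⊤                                       ∎
  where
  open S4Algebra 𝓑
  open ≈-Reasoning setoid
  A = openGenerated 𝓑

  w : ℕ → S4Algebra.Carrier A
  w n = □ v n , gen (□ v n , □-idem 𝓑 (v n))

  A∈σρ𝐊 : σ (ρ 𝐊) A
  A∈σρ𝐊 = envelope∈σ (𝓑 , 𝓑∈𝐊 , id-≅ᴴ (openAlgebra 𝓑))
    (OpenGeneratedEnvelope.isBooleanEnvelope em zorn 𝓑)

Schem⊆Log-σρ : (𝐊 : Pred (S4Alg ℓ) k) → ∀ φ → Schem (Log 𝐊 ^□) φ → Log (σ (ρ 𝐊)) φ
Schem⊆Log-σρ 𝐊 φ valid A A∈σρ𝐊 =
  valid-σ φ (λ H∈ρ𝐊 env → envelope-valid φ valid H∈ρ𝐊 env) A∈σρ𝐊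

corollary6p8 : ∀ {ℓ k m} →
    (ExcludedMiddle (suc ℓ) → ZornsLemma (suc ℓ) →
    (𝐊 : Pred (S4Alg ℓ) k) → IsVariety 𝐊 →
    Log (σ (ρ 𝐊)) ≐ Schem (Log 𝐊 ^□))
    ×
    ((L : NExtS4 m) → □-Maximal L ⇔ IsGreatestModalCompanion L (ρᴸ L))
corollary6p8 =
  (λ em zorn 𝐊 _ →
    (λ {φ} → Log-σρ⊆Schem em zorn 𝐊 φ) , (λ {φ} → Schem⊆Log-σρ 𝐊 φ)) ,
  □-maximal⇔greatest-companion
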